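{- Let $n\ge 2$. The variety $\mathbf{V(C_n^{dp})}\vee\mathbf{V(D_2)}$ is defined, modulo $\mathbf{JIDL_1}$, by the identity $$x_1\vee x_2\vee\cdots\vee x_n\vee(x_1\to x_2)\vee(x_2\to x_3)\vee\cdots\vee(x_{n-1}\to x_n)\approx 1;$$ that is, it is exactly the class of algebras in $\mathbf{JIDL_1}$ satisfying this identity.
   Context: A semi-Heyting algebra is an algebra $\langle L,\vee,\wedge,\to,0,1\rangle$ such that $\langle L,\vee,\wedge,0,1\rangle$ is a bounded lattice and the identities $x\wedge(x\to y)\approx x\wedge y$, $x\wedge(y\to z)\approx x\wedge[(x\wedge y)\to(x\wedge z)]$, $x\to x\approx 1$ hold; it is a Heyting algebra if moreover $(x\wedge y)\to y\approx 1$. Write $x^*:=x\to 0$. A $\mathbf{DQD}$-algebra (dually quasi-De Morgan semi-Heyting algebra) is an algebra $\langle L,\vee,\wedge,\to,{}',0,1\rangle$ whose reduct $\langle L,\vee,\wedge,\to,0,1\rangle$ is a semi-Heyting algebra and which satisfies: $0'\approx 1$ and $1'\approx 0$; $(x\wedge y)'\approx x'\vee y'$; $(x\vee y)''\approx x''\vee y''$; $x''\le x$. $\mathbf{DQD}$ denotes the variety of all $\mathbf{DQD}$-algebras. $\mathbf{JIDL_1}$ is the subvariety of $\mathbf{DQD}$ defined by the identities $x'\vee(y\to z)\approx(x'\vee y)\to(x'\vee z)$, $(x\to y)\vee(y\to x)\approx 1$, and $x\wedge x'^{*}\approx (x\wedge x'^{*})'^{*}$ (where $z'^*$ means $(z')^*$);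 in the presence of the first identity, the last is equivalent to the level-1 identity $x\wedge x'^*\approx x\wedge x'^*\wedge x'^*{}'^*$. A dually Stone Heyting chain is a $\mathbf{DQD}$-algebra satisfying $x'\wedge x''\approx 0$ whose semi-Heyting reduct is a Heyting algebra and whose lattice reduct is a chain; $\mathbf{C_n^{dp}}$ is the (unique up to isomorphism) $n$-element dually Stone Heyting chain. $\mathbf{D_2}$ is the $\mathbf{DQD}$-algebra whose reduct without $'$ is the four-element Boolean algebra $\{0,a,b,1\}$ with its Heyting implication ($x\to y$ is the join of the complement of $x$ with $y$), and with $0'=1$, $1'=0$, $a'=a$, $b'=b$. $\mathbf{V(K)}$ denotes the variety generated by $\mathbf{K}$, and $\vee$ between varieties is the join of varieties. -}

module Defs where

open import Algebra.Core using (Op₁; Op₂)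
import Algebra.Construct.NaturalChoice.Max as Max
import Algebra.Construct.NaturalChoice.Min as Min
import Algebra.Construct.NaturalChoice.MinMaxOp as MinMaxOp
import Algebra.Definitions as Definitions
import Algebra.Lattice.Construct.NaturalChoice.MinMaxOp as LatticeMinMaxOp
open import Algebra.Lattice.Structures using (IsLattice)
open import Data.Bool.Base as Bool using (Bool; true; false; not; if_then_else_)
open import Data.Fin.Base as Fin using (Fin; fromℕ)
open import Data.Fin.Properties as Fin using (_≟_; _≤?_; ≤fromℕ)
open import Data.List.Base using (List; []; _∷_; _++_; map; upTo)
open import Data.Nat.Base using (ℕ; suc; 2+; _∸_; z≤n; NonTrivial)
import Data.Nat.Properties as ℕ
open import Data.Product.Base using (_×_; _,_)
open import Data.Sum.Base as Sum using (_⊎_; inj₁; inj₂)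
open import Function.Base using (_∘_)
open import Level using (Level; 0ℓ; _⊔_) renaming (suc to ℓsuc)
open import Relation.Binary.Core using (Rel)
open import Relation.Binary.Definitions using (Total)
open import Relation.Binary.Structures using (IsEquivalence)
open import Relation.Binary.PropositionalEquality
  using (_≡_; _≢_; refl; sym; trans; cong; cong₂; subst; isEquivalence)
open import Relation.Nullary using (yes; no; does)
open import Relation.Nullary.Decidable using (dec-true; dec-false)
open import Relation.Unary using (Pred; _⊆_; _∪_; _∈_)

private
  variable
    c ℓ c′ ℓ′ p q : Level

-- Algebras ⟨L, ∨, ∧, →, ′, 0, 1⟩ over a setoid.  The constants 0 and 1
-- are written ⊥ and ⊤.  No identities are imposed here.

record Alg c ℓ : Set (ℓsuc (c ⊔ ℓ)) where
  infix  4 _≈_ _≤_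
  infixr 5 _⇒_
  infixr 6 _∨_
  infixr 7 _∧_
  infix  8 _′ _*
  field
    Carrier       : Set c
    _≈_           : Rel Carrier ℓ
    _∨_ _∧_ _⇒_   : Op₂ Carrier
    _′            : Op₁ Carrier
    ⊥ ⊤           : Carrier
    isEquiv       : IsEquivalence _≈_
    ∨-cong        : Definitions.Congruent₂ _≈_ _∨_
    ∧-cong        : Definitions.Congruent₂ _≈_ _∧_
    ⇒-cong        : Definitions.Congruent₂ _≈_ _⇒_
    ′-cong        : Definitions.Congruent₁ _≈_ _′

  _≤_ : Rel Carrier ℓ
  x ≤ y = x ∧ y ≈ x

  _* : Op₁ Carrier
  x * = x ⇒ ⊥

module _ (A : Alg c ℓ) where
  open Alg A
  open Definitions _≈_ using (RightZero)

  record IsSemiHeyting : Set (c ⊔ ℓ) where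
    field
      isLattice : IsLattice _≈_ _∨_ _∧_
      ∧-zeroʳ   : RightZero ⊥ _∧_
      ∨-zeroʳ   : RightZero ⊤ _∨_
      ∧-⇒       : ∀ x y → x ∧ (x ⇒ y) ≈ x ∧ y
      ∧-⇒-∧     : ∀ x y z → x ∧ (y ⇒ z) ≈ x ∧ ((x ∧ y) ⇒ (x ∧ z))
      ⇒-refl    : ∀ x → x ⇒ x ≈ ⊤

  record IsHeyting : Set (c ⊔ ℓ) where
    field
      isSemiHeyting : IsSemiHeyting
      ∧⇒-⊤          : ∀ x y → (x ∧ y) ⇒ y ≈ ⊤

  record IsDQD : Set (c ⊔ ℓ) where
    field
      isSemiHeyting : IsSemiHeyting
      ⊥′            : ⊥ ′ ≈ ⊤
      ⊤′            : ⊤ ′ ≈ ⊥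
      ∧-′           : ∀ x y → (x ∧ y) ′ ≈ x ′ ∨ y ′
      ∨-′′          : ∀ x y → ((x ∨ y) ′) ′ ≈ (x ′) ′ ∨ (y ′) ′
      ′′-≤          : ∀ x → (x ′) ′ ≤ x

  record IsJIDL₁ : Set (c ⊔ ℓ) where
    field
      isDQD   : IsDQD
      jid     : ∀ x y z → x ′ ∨ (y ⇒ z) ≈ (x ′ ∨ y) ⇒ (x ′ ∨ z)
      linear  : ∀ x y → (x ⇒ y) ∨ (y ⇒ x) ≈ ⊤
      level-1 : ∀ x → x ∧ (x ′) * ≈ ((x ∧ (x ′) *) ′) *

  record IsDuallyStoneHeytingChain : Set (c ⊔ ℓ) where
    field
      isDQD        : IsDQD
      dually-stone : ∀ x → x ′ ∧ (x ′) ′ ≈ ⊥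
      isHeyting    : IsHeyting
      ≤-total      : Total _≤_

JIDL₁ : Pred (Alg c ℓ) (c ⊔ ℓ)
JIDL₁ = IsJIDL₁

infixr 5 _⇒ₜ_
infixr 6 _∨ₜ_
infixr 7 _∧ₜ_
infix  8 _′ₜ
infix  4 _≈ₜ_

data Term : Set where
  var            : ℕ → Term
  _∨ₜ_ _∧ₜ_ _⇒ₜ_ : Term → Term → Term
  _′ₜ            : Term → Term
  ⊥ₜ ⊤ₜ          : Term

record Identity : Set where
  constructor _≈ₜ_
  field
    lhs rhs : Term

module _ (A : Alg c ℓ) where
  open Alg A

  ⟦_⟧ : Term → (ℕ → Carrier) → Carrier
  ⟦ var i  ⟧ ρ = ρ i
  ⟦ s ∨ₜ t ⟧ ρ = ⟦ s ⟧ ρ ∨ ⟦ t ⟧ ρ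
  ⟦ s ∧ₜ t ⟧ ρ = ⟦ s ⟧ ρ ∧ ⟦ t ⟧ ρ
  ⟦ s ⇒ₜ t ⟧ ρ = ⟦ s ⟧ ρ ⇒ ⟦ t ⟧ ρ
  ⟦ t ′ₜ   ⟧ ρ = (⟦ t ⟧ ρ) ′
  ⟦ ⊥ₜ     ⟧ ρ = ⊥
  ⟦ ⊤ₜ     ⟧ ρ = ⊤

  infix 4 _⊨_

  _⊨_ : Identity → Set (c ⊔ ℓ)
  _⊨_ (s ≈ₜ t) = ∀ ρ → ⟦ s ⟧ ρ ≈ ⟦ t ⟧ ρ

-- A variety is the class of all models of some set of identities.

Mod : Pred Identity p → Pred (Alg c ℓ) (p ⊔ c ⊔ ℓ)
Mod E A = ∀ {e} → e ∈ E → A ⊨ e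

-- The smallest variety containing K, as the intersection of all of them.
-- The members of K and of the generated variety may live in different
-- universes, since a set of identities has models in every universe.

V : Pred (Alg c ℓ) p → Pred (Alg c′ ℓ′) (ℓsuc (c ⊔ ℓ) ⊔ p ⊔ c′ ⊔ ℓ′ ⊔ ℓsuc 0ℓ)
V K A = ∀ (E : Pred Identity 0ℓ) → K ⊆ Mod E → A ∈ Mod E

infixr 6 _∨ᵛ_

_∨ᵛ_ : Pred (Alg c ℓ) p → Pred (Alg c ℓ) q →
       Pred (Alg c ℓ) (ℓsuc (c ⊔ ℓ) ⊔ p ⊔ q)
𝒱 ∨ᵛ 𝒲 = V (𝒱 ∪ 𝒲)

⋁ : List Term → Term
⋁ []           = ⊥ₜ
⋁ (t ∷ [])     = t
⋁ (t ∷ u ∷ us) = t ∨ₜ ⋁ (u ∷ us)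

-- x₁ ∨ ⋯ ∨ xₙ ∨ (x₁ → x₂) ∨ ⋯ ∨ (xₙ₋₁ → xₙ) ≈ 1, with xᵢ₊₁ encoded as var i.

chainIdentity : ℕ → Identity
chainIdentity n =
  ⋁ (map var (upTo n) ++ map (λ i → var i ⇒ₜ var (suc i)) (upTo (n ∸ 1))) ≈ₜ ⊤ₜ

-- The n-element dually Stone Heyting chain: the axioms force x → y to be 1
-- when x ≤ y and y otherwise, and x ′ to be 0 when x = 1 and 1 otherwise.

module Chain (k : ℕ) where
  open Min (Fin.≤-totalOrder (2+ k)) public using (_⊓_)
  open Max (Fin.≤-totalOrder (2+ k)) public
    using () renaming (_⊔_ to _⊔ᶠ_)

  0ᶜ 1ᶜ : Fin (2+ k)
  0ᶜ = Fin.zero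
  1ᶜ = fromℕ (suc k)

  _⇒ᶜ_ : Op₂ (Fin (2+ k))
  x ⇒ᶜ y = if does (x ≤? y) then 1ᶜ else y

  _′ᶜ : Op₁ (Fin (2+ k))
  x ′ᶜ = if does (x ≟ 1ᶜ) then 0ᶜ else 1ᶜ

Cᵈᵖ : (n : ℕ) → .{{NonTrivial n}} → Alg 0ℓ 0ℓ
Cᵈᵖ (2+ k) = record
  { Carrier = Fin (2+ k)
  ; _≈_     = _≡_
  ; _∨_     = _⊔ᶠ_
  ; _∧_     = _⊓_
  ; _⇒_     = _⇒ᶜ_
  ; _′      = _′ᶜ
  ; ⊥       = 0ᶜ
  ; ⊤       = 1ᶜ
  ; isEquiv = isEquivalence
  ; ∨-cong  = cong₂ _⊔ᶠ_
  ; ∧-cong  = cong₂ _⊓_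
  ; ⇒-cong  = cong₂ _⇒ᶜ_
  ; ′-cong  = cong _′ᶜ
  } where open Chain k

-- The four-element Boolean algebra as Bool × Bool, with a = (true , false)
-- and b = (false , true).  Complementing and swapping the coordinates
-- exchanges 0 and 1 and fixes a and b.

D₂ : Alg 0ℓ 0ℓ
D₂ = record
  { Carrier = Bool × Bool
  ; _≈_     = _≡_
  ; _∨_     = λ (x₁ , x₂) (y₁ , y₂) → x₁ Bool.∨ y₁ , x₂ Bool.∨ y₂
  ; _∧_     = λ (x₁ , x₂) (y₁ , y₂) → x₁ Bool.∧ y₁ , x₂ Bool.∧ y₂
  ; _⇒_     = λ (x₁ , x₂) (y₁ , y₂) → not x₁ Bool.∨ y₁ , not x₂ Bool.∨ y₂
  ; _′      = λ (x₁ , x₂) → not x₂ , not x₁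
  ; ⊥       = false , false
  ; ⊤       = true , true
  ; isEquiv = isEquivalence
  ; ∨-cong  = λ { refl refl → refl }
  ; ∧-cong  = λ { refl refl → refl }
  ; ⇒-cong  = λ { refl refl → refl }
  ; ′-cong  = λ { refl → refl }
  }

module _ (k : ℕ) where
  private
    O = Fin.≤-totalOrder (2+ k)
    module Mn = Min O
    module Mx = Max O
    module MM = MinMaxOp Mn.minOperator Mx.maxOperator
    module LM = LatticeMinMaxOp Mn.minOperator Mx.maxOperator
    open Chain k
    L = Fin (2+ k)

    max : (x : L) → x Fin.≤ 1ᶜ
    max = ≤fromℕ

    min : (x : L) → 0ᶜ Fin.≤ x
    min _ = z≤n

    ⇒-≤ : ∀ {x y : L} → x Fin.≤ y → x ⇒ᶜ y ≡ 1ᶜ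
    ⇒-≤ {x} {y} x≤y rewrite dec-true (x ≤? y) x≤y = refl

    ⇒-> : ∀ {x y : L} → y Fin.< x → x ⇒ᶜ y ≡ y
    ⇒-> {x} {y} y<x rewrite dec-false (x ≤? y) (ℕ.<⇒≱ y<x) = refl

    ≤⊎> : (x y : L) → x Fin.≤ y ⊎ y Fin.< x
    ≤⊎> x y = ℕ.≤-<-connex (Fin.toℕ x) (Fin.toℕ y)

    ′-1 : 1ᶜ ′ᶜ ≡ 0ᶜ
    ′-1 rewrite dec-true (1ᶜ ≟ 1ᶜ) refl = refl

    ′-≢1 : ∀ {x} → x ≢ 1ᶜ → x ′ᶜ ≡ 1ᶜ
    ′-≢1 {x} x≢1 rewrite dec-false (x ≟ 1ᶜ) x≢1 = refl

    ′-anti : ∀ {x y : L} → x Fin.≤ y → y ′ᶜ Fin.≤ x ′ᶜ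
    ′-anti {x} {y} x≤y with x ≟ 1ᶜ
    ... | no _ = max (y ′ᶜ)
    ... | yes refl rewrite Fin.≤-antisym (max y) x≤y | ′-1 = z≤n

    ∧-⇒ᶜ : ∀ x y → x ⊓ (x ⇒ᶜ y) ≡ x ⊓ y
    ∧-⇒ᶜ x y with ≤⊎> x y
    ... | inj₁ x≤y rewrite ⇒-≤ x≤y =
      trans (Mn.⊓-identityʳ max x) (sym (Mn.x≤y⇒x⊓y≈x x≤y))
    ... | inj₂ y<x = cong (x ⊓_) (⇒-> y<x)

    ∧-⇒-∧ᶜ : ∀ x y z → x ⊓ (y ⇒ᶜ z) ≡ x ⊓ ((x ⊓ y) ⇒ᶜ (x ⊓ z))
    ∧-⇒-∧ᶜ x y z with ≤⊎> y z
    ... | inj₁ y≤z = cong (x ⊓_)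
      (trans (⇒-≤ y≤z) (sym (⇒-≤ (Mn.⊓-monoʳ-≤ x y≤z))))
    ... | inj₂ z<y rewrite ⇒-> z<y with ≤⊎> x z
    ...   | inj₁ x≤z
            rewrite Mn.x≤y⇒x⊓y≈x x≤z
                  | Mn.x≤y⇒x⊓y≈x (ℕ.≤-trans x≤z (ℕ.<⇒≤ z<y))
                  | ⇒-≤ (ℕ.≤-refl {Fin.toℕ x})
            = sym (Mn.⊓-identityʳ max x)
    ...   | inj₂ z<x = cong (x ⊓_) (sym (trans
              (cong ((x ⊓ y) ⇒ᶜ_) (Mn.x≤y⇒y⊓x≈x {z} {x} (ℕ.<⇒≤ z<x)))
              (⇒-> {x ⊓ y} {z} z<x⊓y)))
      where
      z<x⊓y : z Fin.< x ⊓ y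
      z<x⊓y with Mn.⊓-sel x y
      ... | inj₁ eq = subst (z Fin.<_) (sym eq) z<x
      ... | inj₂ eq = subst (z Fin.<_) (sym eq) z<y

    0′ : 0ᶜ ′ᶜ ≡ 1ᶜ
    0′ = ′-≢1 {0ᶜ} λ ()

    ′′-≤ᶜ : ∀ x → (x ′ᶜ) ′ᶜ ⊓ x ≡ (x ′ᶜ) ′ᶜ
    ′′-≤ᶜ x with x ≟ 1ᶜ
    ... | yes refl = Mn.⊓-identityʳ max _
    ... | no _ rewrite ′-1 = Mn.⊓-zeroˡ min x

    dually-stoneᶜ : ∀ x → x ′ᶜ ⊓ (x ′ᶜ) ′ᶜ ≡ 0ᶜ
    dually-stoneᶜ x with x ≟ 1ᶜ
    ... | yes _ = Mn.⊓-zeroˡ min (0ᶜ ′ᶜ)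
    ... | no _ rewrite ′-1 = Mn.⊓-zeroʳ min 1ᶜ

    isSemiHeyting : IsSemiHeyting (Cᵈᵖ (2+ k))
    isSemiHeyting = record
      { isLattice = LM.⊔-⊓-isLattice
      ; ∧-zeroʳ   = Mn.⊓-zeroʳ min
      ; ∨-zeroʳ   = Mx.⊔-zeroʳ max
      ; ∧-⇒       = ∧-⇒ᶜ
      ; ∧-⇒-∧     = ∧-⇒-∧ᶜ
      ; ⇒-refl    = λ x → ⇒-≤ (ℕ.≤-refl {Fin.toℕ x})
      }

    isDQD : IsDQD (Cᵈᵖ (2+ k))
    isDQD = record
      { isSemiHeyting = isSemiHeyting
      ; ⊥′            = 0′
      ; ⊤′            = ′-1
      ; ∧-′           = MM.antimono-≤-distrib-⊓ (cong _′ᶜ) ′-anti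
      ; ∨-′′          = Mx.mono-≤-distrib-⊔ (cong (_′ᶜ ∘ _′ᶜ)) (′-anti ∘ ′-anti)
      ; ′′-≤          = ′′-≤ᶜ
      }

    total : Total (Alg._≤_ (Cᵈᵖ (2+ k)))
    total x y = Sum.map Mn.x≤y⇒x⊓y≈x Mn.x≤y⇒x⊓y≈x (Fin.≤-total x y)

  Cᵈᵖ-isDuallyStoneHeytingChain : IsDuallyStoneHeytingChain (Cᵈᵖ (2+ k))
  Cᵈᵖ-isDuallyStoneHeytingChain = record
    { isDQD        = isDQD
    ; dually-stone = dually-stoneᶜ
    ; isHeyting    = record
      { isSemiHeyting = isSemiHeyting
      ; ∧⇒-⊤          = λ x y → ⇒-≤ (Mn.x⊓y≤y x y)
      }
    ; ≤-total      = total
    }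

module Submission where

-- Let A be in JIDL₁, satisfying the chain identity, and let s ≈ t hold in
-- the n-element chain and in D₂; the point is to prove s ≈ t in A.  Instead
-- of representing A by subdirectly irreducible algebras, which needs choice,
-- the proof splits A into a product of two quotients as often as the finitely
-- many variables of s and t require.
--
-- Linearity makes every algebra of JIDL₁ a Heyting algebra (≤⇒⇒-⊤), and the
-- first identity makes every x ′ complemented (x′∨x′*≈⊤).  By the level-1
-- identity, e = w ∧ (w ′) * and e ′ are complements of each other, and
-- x ∼ y iff e ∧ x ≈ e ∧ y is a congruence, as is the same with e ′.  In the
-- first quotient w ≈ ⊤, in the second w ≤ w ′, and an equation true in both is
-- true in A (decide).  Applying this to w and to w ′ leads to quotients where
-- ′ has a fixed point, or w ≈ ⊤, or w ′ ≈ ⊤ (dichotomy).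
--
-- If ′ has a fixed point c, then, after another splitting, c and its
-- complement play the part of the atoms of D₂, and further splittings place
-- each variable in a copy of D₂ (fixedPoint⇒⊨).  Otherwise apply the
-- dichotomy to x → y and y → x: since ′′ preserves joins, w ′ ≈ ⊤ makes w
-- irrelevant to a join being ⊤, so linearity makes the variables comparable,
-- and they can be sorted, with ⊥ and ⊤, into a strictly ascending list (sort).
-- In a list with more than n elements the join of the chain identity would be
-- irrelevant, so ⊤ ≈ ⊥ (chainIdentity⇒short); in a shorter one the variables
-- lie in a copy of a subalgebra of the n-element chain (Rank-compatible).
--
-- Conversely, JIDL₁ is equational, and both generators satisfy its axioms and
-- the chain identity: n elements of the n-element chain either descend
-- strictly from the top, or x → y ≈ ⊤ for two consecutive ones.

open import Defs
import Algebra.Construct.NaturalChoice.Max as Max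
import Algebra.Construct.NaturalChoice.Min as Min
open import Algebra.Core using (Op₁)
import Algebra.Definitions as Definitions
open import Algebra.Lattice.Bundles using (Lattice)
import Algebra.Lattice.Properties.Lattice as LatticeProperties
open import Data.Bool.Base as Bool using (Bool; true; false; not)
import Data.Bool.Properties as Bool
open import Data.Fin.Base as Fin using (Fin; zero; suc; fromℕ; toℕ)
import Data.Fin.Properties as Fin
open import Data.List.Base using (List; []; _∷_; _++_; length; map; upTo; applyUpTo)
open import Data.List.Membership.Propositional using () renaming (_∈_ to _∈ₗ_)
open import Data.List.Membership.Propositional.Properties using (∈-++⁺ʳ; ∈-map⁺; ∈-upTo⁺)
open import Data.List.Relation.Unary.All as All using (All; []; _∷_)
import Data.List.Relation.Unary.All.Properties as All
open import Data.List.Relation.Unary.AllPairs using (AllPairs; []; _∷_)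
open import Data.List.Relation.Unary.Any as Any using (Any; here; there)
open import Data.List.Relation.Unary.Linked as Linked using (Linked; []; [-]; _∷_)
import Data.List.Relation.Unary.Linked.Properties as Linked
open import Data.Nat.Base as ℕ using (ℕ; zero; suc; 2+; NonTrivial)
import Data.Nat.Properties as ℕ
open import Data.Product.Base using (_×_; _,_; proj₁; proj₂; ∃-syntax)
open import Data.Product.Properties using (≡-dec)
open import Data.Sum.Base using (_⊎_; inj₁; inj₂)
open import Function.Base using (_$_; _∘_; case_of_)
open import Function.Bundles using (_⇔_; mk⇔)
open import Level using (Level; Lift; lift; lower; 0ℓ; _⊔_) renaming (suc to ℓsuc)
open import Relation.Binary.Bundles using (Poset)
open import Relation.Binary.Core using (Rel; REL)
open import Relation.Binary.Lattice.Bundles using (HeytingAlgebra)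
import Relation.Binary.Lattice.Properties.HeytingAlgebra as HeytingProperties
import Relation.Binary.Lattice.Structures as Order
open import Relation.Binary.PropositionalEquality as ≡ using (_≡_; _≢_)
open import Relation.Binary.Structures using (IsEquivalence)
open import Relation.Nullary using (Dec; yes; no; contradiction)
open import Relation.Nullary.Decidable using (dec-true; dec-false; from-yes; map′; _×-dec_)
open import Relation.Unary using (Pred; _∈_; _⊆_; _∪_; ｛_｝)

-- Arithmetic of JIDL₁-algebras

module Residuation {c ℓ} {A : Alg c ℓ} (isJIDL₁ : IsJIDL₁ A) where

  open Alg A hiding (_≤_)
  open IsJIDL₁ isJIDL₁
  open IsDQD isDQD
  open IsSemiHeyting isSemiHeyting

  lattice : Lattice c ℓ
  lattice = record { isLattice = isLattice }

  open Lattice lattice using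
    (setoid; sym; ∧-comm; ∧-congˡ; ∧-absorbs-∨)
    renaming (trans to ≈-trans)
  open LatticeProperties lattice using
    (∧-idem; poset; ∨-∧-isOrderTheoreticLattice)
  open Poset poset using (_≤_)
  open Order.IsLattice ∨-∧-isOrderTheoreticLattice using
    (x∧y≤x; x∧y≤y; ∧-greatest; antisym; x≤x∨y; y≤x∨y; ∨-least)
  open import Relation.Binary.Reasoning.Setoid setoid

  ∧-identityʳ : ∀ x → x ∧ ⊤ ≈ x
  ∧-identityʳ x = begin
    x ∧ ⊤        ≈⟨ ∧-congˡ (∨-zeroʳ x) ⟨
    x ∧ (x ∨ ⊤)  ≈⟨ ∧-absorbs-∨ x ⊤ ⟩
    x            ∎

  -- In a semi-Heyting algebra y → x always lies below x → y when x ≤ y, so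
  -- linearity collapses (x → y) ∨ (y → x) to x → y.

  ≤⇒⇒-⊤ : ∀ {x y} → x ≤ y → x ⇒ y ≈ ⊤
  ≤⇒⇒-⊤ {x} {y} x≤y = begin
    x ⇒ y              ≈⟨ antisym (x≤x∨y _ _) (∨-least (sym (∧-idem _)) v≤u) ⟩
    (x ⇒ y) ∨ (y ⇒ x)  ≈⟨ linear x y ⟩
    ⊤                  ∎
    where
    v = y ⇒ x

    v∧x : v ∧ x ≈ x
    v∧x = begin
      v ∧ x                    ≈⟨ ∧-comm v x ⟩
      x ∧ (y ⇒ x)              ≈⟨ ∧-⇒-∧ x y x ⟩
      x ∧ ((x ∧ y) ⇒ (x ∧ x))  ≈⟨ ∧-congˡ (⇒-cong (sym x≤y) (∧-idem x)) ⟩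
      x ∧ (x ⇒ x)              ≈⟨ ∧-congˡ (⇒-refl x) ⟩
      x ∧ ⊤                    ≈⟨ ∧-identityʳ x ⟩
      x                        ∎

    v∧y : v ∧ y ≈ x
    v∧y = begin
      v ∧ y  ≈⟨ ∧-comm v y ⟩
      y ∧ v  ≈⟨ ∧-⇒ y x ⟩
      y ∧ x  ≈⟨ ∧-comm y x ⟩
      x ∧ y  ≈⟨ x≤y ⟨
      x      ∎

    v≤u : v ≤ (x ⇒ y)
    v≤u = sym $ begin
      v ∧ (x ⇒ y)              ≈⟨ ∧-⇒-∧ v x y ⟩
      v ∧ ((v ∧ x) ⇒ (v ∧ y))  ≈⟨ ∧-congˡ (⇒-cong v∧x v∧y) ⟩
      v ∧ (x ⇒ x)              ≈⟨ ∧-congˡ (⇒-refl x) ⟩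
      v ∧ ⊤                    ≈⟨ ∧-identityʳ v ⟩
      v                        ∎

  -- Hence → is the residual of ∧.  Here, and from now on, x ≤ y stands for
  -- x ≈ x ∧ y.

  heytingAlgebra : HeytingAlgebra c ℓ ℓ
  heytingAlgebra = record
    { _≈_ = _≈_ ; _≤_ = _≤_ ; _∨_ = _∨_ ; _∧_ = _∧_ ; _⇨_ = _⇒_
    ; ⊤ = ⊤ ; ⊥ = ⊥
    ; isHeytingAlgebra = record
      { isBoundedLattice = record
        { isLattice = ∨-∧-isOrderTheoreticLattice
        ; maximum   = λ x → sym (∧-identityʳ x)
        ; minimum   = λ x → sym (≈-trans (∧-comm ⊥ x) (∧-zeroʳ x))
        }
      ; exponential = λ w x y → curry w x y , uncurry w x y
      }
    }
    where
    curry : ∀ w x y → (w ∧ x) ≤ y → w ≤ (x ⇒ y)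
    curry w x y w∧x≤y = sym $ begin
      w ∧ (x ⇒ y)              ≈⟨ ∧-⇒-∧ w x y ⟩
      w ∧ ((w ∧ x) ⇒ (w ∧ y))  ≈⟨ ∧-congˡ (≤⇒⇒-⊤ (∧-greatest (x∧y≤x w x) w∧x≤y)) ⟩
      w ∧ ⊤                    ≈⟨ ∧-identityʳ w ⟩
      w                        ∎

    uncurry : ∀ w x y → w ≤ (x ⇒ y) → (w ∧ x) ≤ y
    uncurry w x y w≤x⇒y = Poset.trans poset
      (∧-greatest (x∧y≤y w x) (Poset.trans poset (x∧y≤x w x) w≤x⇒y))
      (Poset.trans poset (Poset.reflexive poset (∧-⇒ x y)) (x∧y≤y x y))

module JIDL₁-Properties {c ℓ} {A : Alg c ℓ} (isJIDL₁ : IsJIDL₁ A) where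

  open Alg A hiding (_≤_)
  open IsJIDL₁ isJIDL₁ public
  open IsDQD isDQD public
  open IsSemiHeyting isSemiHeyting public
  open Residuation isJIDL₁ public using (lattice; ≤⇒⇒-⊤; heytingAlgebra)
  open Lattice lattice public using
    (setoid; refl; sym; ∨-comm; ∨-assoc; ∧-comm; ∧-assoc; ∨-absorbs-∧; ∧-absorbs-∨; ∧-congˡ; ∧-congʳ; ∨-congʳ)
    renaming (trans to ≈-trans)
  open HeytingAlgebra heytingAlgebra public using
    (_≤_; antisym; reflexive; x≤x∨y; y≤x∨y; ∨-least; x∧y≤x; x∧y≤y;
     ∧-greatest; maximum; minimum; transpose-⇨; transpose-∧)
    renaming (refl to ≤-refl; trans to ≤-trans)
  open import Relation.Binary.Reasoning.Setoid setoid

  open HeytingProperties heytingAlgebra public using (∧-distribˡ-∨)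

  ∧-≤-∧ : ∀ {x y z w} → x ≤ y → z ≤ w → x ∧ z ≤ y ∧ w
  ∧-≤-∧ x≤y z≤w = ∧-greatest (≤-trans (x∧y≤x _ _) x≤y) (≤-trans (x∧y≤y _ _) z≤w)

  ∨-distrib-≤ : ∀ {x y z w} → x ∧ y ≤ w → x ∧ z ≤ w → x ∧ (y ∨ z) ≤ w
  ∨-distrib-≤ p q = ≤-trans (reflexive (∧-distribˡ-∨ _ _ _)) (∨-least p q)

  ⊤≤⇒≈⊤ : ∀ {x} → ⊤ ≤ x → x ≈ ⊤
  ⊤≤⇒≈⊤ = antisym (maximum _)

  ≤⊥⇒≈⊥ : ∀ {x} → x ≤ ⊥ → x ≈ ⊥
  ≤⊥⇒≈⊥ x≤⊥ = antisym x≤⊥ (minimum _)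

  ≈⊤⇒≥ : ∀ {x y} → y ≈ ⊤ → x ≤ y
  ≈⊤⇒≥ y≈⊤ = ≤-trans (maximum _) (reflexive (sym y≈⊤))

  ⇒-⊤⇒≤ : ∀ {x y} → x ⇒ y ≈ ⊤ → x ≤ y
  ⇒-⊤⇒≤ x⇒y≈⊤ = ≤-trans (∧-greatest (maximum _) ≤-refl)
    (transpose-∧ (reflexive (sym x⇒y≈⊤)))

  ∧-⇒-≤ : ∀ x y → x ∧ (x ⇒ y) ≤ y
  ∧-⇒-≤ x y = ≤-trans (reflexive (∧-⇒ x y)) (x∧y≤y x y)

  x∧x*≈⊥ : ∀ x → x ∧ x * ≈ ⊥
  x∧x*≈⊥ x = ≤⊥⇒≈⊥ (∧-⇒-≤ x ⊥)

  ⊤-⇒ : ∀ x → ⊤ ⇒ x ≈ x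
  ⊤-⇒ x = antisym (≤-trans (∧-greatest (maximum _) ≤-refl) (∧-⇒-≤ ⊤ x))
    (transpose-⇨ (x∧y≤x x ⊤))

  ⊤≈⊥⇒≈ : ⊤ ≈ ⊥ → ∀ x y → x ≈ y
  ⊤≈⊥⇒≈ ⊤≈⊥ x y = antisym (bottom x y) (bottom y x)
    where
    bottom : ∀ x y → x ≤ y
    bottom x y = ≤-trans (maximum x) (≤-trans (reflexive ⊤≈⊥) (minimum y))

  ′-anti : ∀ {x y} → x ≤ y → y ′ ≤ x ′
  ′-anti {x} {y} x≤y = ≤-trans (y≤x∨y _ _)
    (reflexive (sym (≈-trans (′-cong x≤y) (∧-′ x y))))

  x′′≤x : ∀ x → (x ′) ′ ≤ x
  x′′≤x x = sym (′′-≤ x)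

  -- Every x ′ is complemented, by (x ′) *.

  x′∨x′*≈⊤ : ∀ x → x ′ ∨ (x ′) * ≈ ⊤
  x′∨x′*≈⊤ x = ≈-trans (jid x (x ′) ⊥) (≤⇒⇒-⊤ (∨-least (x≤x∨y _ _) (x≤x∨y _ _)))

  ′≈⊤⇒′′≈⊥ : ∀ {x} → x ′ ≈ ⊤ → (x ′) ′ ≈ ⊥
  ′≈⊤⇒′′≈⊥ x′≈⊤ = ≈-trans (′-cong x′≈⊤) ⊤′

  ⊤′′≈⊤ : (⊤ ′) ′ ≈ ⊤
  ⊤′′≈⊤ = ≈-trans (′-cong ⊤′) ⊥′

  -- An element with x ′ ≈ ⊤ does not contribute to a join equal to ⊤, because
  -- ′′ preserves joins and kills x.

  ∨≈⊤∧′≈⊤⇒≈⊤ : ∀ {x y} → x ∨ y ≈ ⊤ → x ′ ≈ ⊤ → y ≈ ⊤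
  ∨≈⊤∧′≈⊤⇒≈⊤ {x} {y} x∨y≈⊤ x′≈⊤ = ⊤≤⇒≈⊤ (≤-trans
    (reflexive (begin
      ⊤                    ≈⟨ ⊤′′≈⊤ ⟨
      (⊤ ′) ′              ≈⟨ ′-cong (′-cong x∨y≈⊤) ⟨
      ((x ∨ y) ′) ′        ≈⟨ ∨-′′ x y ⟩
      (x ′) ′ ∨ (y ′) ′    ≈⟨ ∨-congʳ (′≈⊤⇒′′≈⊥ x′≈⊤) ⟩
      ⊥ ∨ (y ′) ′          ∎))
    (∨-least (minimum y) (x′′≤x y)))

  -- An element below w, complemented by its own ′, so that both e = core w and
  -- e ′ cut out direct factors.

  core : Op₁ Carrier
  core w = w ∧ (w ′) *

  core∧core′≈⊥ : ∀ w → core w ∧ (core w) ′ ≈ ⊥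
  core∧core′≈⊥ w = begin
    core w ∧ (core w) ′          ≈⟨ ∧-congʳ (level-1 w) ⟩
    ((core w) ′) * ∧ (core w) ′  ≈⟨ ∧-comm _ _ ⟩
    (core w) ′ ∧ ((core w) ′) *  ≈⟨ x∧x*≈⊥ _ ⟩
    ⊥                            ∎

  core∨core′≈⊤ : ∀ w → core w ∨ (core w) ′ ≈ ⊤
  core∨core′≈⊤ w = begin
    core w ∨ (core w) ′          ≈⟨ ∨-congʳ (level-1 w) ⟩
    ((core w) ′) * ∨ (core w) ′  ≈⟨ ∨-comm _ _ ⟩
    (core w) ′ ∨ ((core w) ′) *  ≈⟨ x′∨x′*≈⊤ _ ⟩
    ⊤                            ∎

  core≈⊥⇒≤′ : ∀ {w} → core w ≈ ⊥ → w ≤ w ′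
  core≈⊥⇒≤′ {w} core≈⊥ = ≤-trans
    (∧-greatest ≤-refl (≈⊤⇒≥ (x′∨x′*≈⊤ w)))
    (∨-distrib-≤ (x∧y≤y _ _) (≤-trans (reflexive core≈⊥) (minimum _)))

  -- Strict comparability, as it shows in the operations of a Heyting chain.
  -- It does not exclude x ≈ y ≈ ⊤.

  infix 4 _≺_

  _≺_ : Rel Carrier ℓ
  x ≺ y = x ≤ y × y ⇒ x ≈ x

  ≺-trans : ∀ {x y z} → x ≺ y → y ≺ z → x ≺ z
  ≺-trans (x≤y , y⇒x≈x) (y≤z , _) =
    ≤-trans x≤y y≤z ,
    antisym
      (≤-trans (transpose-⇨ (≤-trans (∧-≤-∧ ≤-refl y≤z)
        (≤-trans (reflexive (∧-comm _ _)) (∧-⇒-≤ _ _)))) (reflexive y⇒x≈x))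
      (transpose-⇨ (x∧y≤x _ _))

  ≺-resp-≈ : ∀ {x x′ y y′} → x ≈ x′ → y ≈ y′ → x ≺ y → x′ ≺ y′
  ≺-resp-≈ x≈x′ y≈y′ (x≤y , y⇒x≈x) =
    ≤-trans (reflexive (sym x≈x′)) (≤-trans x≤y (reflexive y≈y′)) ,
    ≈-trans (⇒-cong (sym y≈y′) (sym x≈x′)) (≈-trans y⇒x≈x x≈x′)

  ≺⊤ : ∀ x → x ≺ ⊤
  ≺⊤ x = maximum x , ⊤-⇒ x

  -- If (y → x) ′ ≈ ⊤ then linearity, applied to y and y → x, forces
  -- y → x to be below y, hence equal to x.

  ≤∧⇒′≈⊤⇒≺ : ∀ {x y} → x ≤ y → (y ⇒ x) ′ ≈ ⊤ → x ≺ y × x ′ ≈ ⊤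
  ≤∧⇒′≈⊤⇒≺ {x} {y} x≤y y⇒x′≈⊤ = (x≤y , y⇒x≈x) , ≈-trans (′-cong (sym y⇒x≈x)) y⇒x′≈⊤
    where
    y⇒y⇒x≈y⇒x : y ⇒ y ⇒ x ≈ y ⇒ x
    y⇒y⇒x≈y⇒x = antisym
      (transpose-⇨ (≤-trans (∧-greatest (x∧y≤y _ _) (≤-trans
        (reflexive (∧-comm _ _)) (∧-⇒-≤ _ _))) (∧-⇒-≤ _ _)))
      (transpose-⇨ (x∧y≤x _ _))

    y⇒x≤y : y ⇒ x ≤ y
    y⇒x≤y = ⇒-⊤⇒≤ (∨≈⊤∧′≈⊤⇒≈⊤ (linear y (y ⇒ x))
      (≈-trans (′-cong y⇒y⇒x≈y⇒x) y⇒x′≈⊤))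

    y⇒x≈x : y ⇒ x ≈ x
    y⇒x≈x = antisym
      (≤-trans (∧-greatest y⇒x≤y ≤-refl) (∧-⇒-≤ _ _))
      (transpose-⇨ (x∧y≤x _ _))

-- Quotients and local truth

-- A quotient of A lying in JIDL₁.  Only the equality changes, so terms have
-- the same values in A and in all of its quotients.

record Quotient {c ℓ} (A : Alg c ℓ) : Set (c ⊔ ℓsuc ℓ) where
  open Alg A using (Carrier; _∨_; _∧_; _⇒_; _′; ⊥; ⊤)
  field
    _~_     : Rel Carrier ℓ
    isEquiv : IsEquivalence _~_
    ∨-cong  : Definitions.Congruent₂ _~_ _∨_
    ∧-cong  : Definitions.Congruent₂ _~_ _∧_
    ⇒-cong  : Definitions.Congruent₂ _~_ _⇒_
    ′-cong  : Definitions.Congruent₁ _~_ _′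

  alg : Alg c ℓ
  alg = record
    { Carrier = Carrier ; _≈_ = _~_
    ; _∨_ = _∨_ ; _∧_ = _∧_ ; _⇒_ = _⇒_ ; _′ = _′ ; ⊥ = ⊥ ; ⊤ = ⊤
    ; isEquiv = isEquiv
    ; ∨-cong = ∨-cong ; ∧-cong = ∧-cong ; ⇒-cong = ⇒-cong ; ′-cong = ′-cong
    }

  field
    isJIDL₁ : IsJIDL₁ alg

module Local {c ℓ} (A : Alg c ℓ) where

  open Alg A hiding (_≤_; isEquiv; ∨-cong; ∧-cong; ⇒-cong; ′-cong)

  private
    variable
      p q : Level
      P : Quotient A → Set p
      P′ : Quotient A → Set q
      θ : Quotient A

  -- The arithmetic of the quotient θ.

  module Q (θ : Quotient A) = JIDL₁-Properties (Quotient.isJIDL₁ θ)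

  infix 3 _⊢_≈_ _⊢_≺_
  infix 4 _⊑_

  _⊢_≈_ : Quotient A → Carrier → Carrier → Set ℓ
  _⊢_≈_ = Quotient._~_

  _⊢_≺_ : Quotient A → Carrier → Carrier → Set ℓ
  θ ⊢ x ≺ y = Q._≺_ θ x y

  -- φ is a further quotient of θ.

  _⊑_ : Quotient A → Quotient A → Set (c ⊔ ℓ)
  θ ⊑ φ = ∀ {x y} → θ ⊢ x ≈ y → φ ⊢ x ≈ y

  ≺-⊑ : ∀ {θ φ} → θ ⊑ φ → ∀ {x y} → θ ⊢ x ≺ y → φ ⊢ x ≺ y
  ≺-⊑ θ⊑φ (x≤y , y⇒x≈x) = θ⊑φ x≤y , θ⊑φ y⇒x≈x

  -- P holds locally at θ: an equation holds in θ as soon as it holds in all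
  -- further quotients satisfying P.  This is the case when θ is a subdirect
  -- product of quotients satisfying P, and it is all that is ever used of such
  -- a decomposition.

  record Loc (P : Quotient A → Set p) (θ : Quotient A) : Set (c ⊔ ℓsuc ℓ ⊔ p) where
    constructor loc
    field
      glue : ∀ {x y} → (∀ φ → θ ⊑ φ → P φ → φ ⊢ x ≈ y) → θ ⊢ x ≈ y

  open Loc public

  return : P θ → Loc P θ
  return p = loc λ k → k _ (λ x≈y → x≈y) p

  bind : Loc P θ → (∀ φ → θ ⊑ φ → P φ → Loc P′ φ) → Loc P′ θ
  bind m f = loc λ k → glue m λ φ θ⊑φ p →
    glue (f φ θ⊑φ p) λ ψ φ⊑ψ → k ψ (φ⊑ψ ∘ θ⊑φ)

  -- In the one-element algebra everything holds locally.

  trivial : θ ⊢ ⊤ ≈ ⊥ → Loc P θ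
  trivial {θ = θ} ⊤≈⊥ = loc λ _ → Q.⊤≈⊥⇒≈ θ ⊤≈⊥ _ _

  -- The quotient identifying e with ⊤, for an element e disjoint from e ′.

  module Principal (θ : Quotient A) (e : Carrier) (e∧e′≈⊥ : θ ⊢ e ∧ e ′ ≈ ⊥) where

    open Q θ
    open Quotient θ using (∨-cong; ∧-cong; ⇒-cong; ′-cong)
    open import Relation.Binary.Reasoning.Setoid setoid

    _∼_ : Rel Carrier ℓ
    x ∼ y = θ ⊢ e ∧ x ≈ e ∧ y

    ≈⇒∼ : ∀ {x y} → θ ⊢ x ≈ y → x ∼ y
    ≈⇒∼ = ∧-congˡ

    ∧-∧ : ∀ x y → θ ⊢ e ∧ (x ∧ y) ≈ e ∧ ((e ∧ x) ∧ y)
    ∧-∧ x y = antisym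
      (∧-greatest (x∧y≤x _ _) (∧-greatest
        (∧-≤-∧ ≤-refl (x∧y≤x _ _)) (≤-trans (x∧y≤y _ _) (x∧y≤y _ _))))
      (∧-≤-∧ ≤-refl (∧-≤-∧ (x∧y≤y _ _) ≤-refl))

    -- The only use of e ∧ e ′ ≈ ⊥: it makes ′ compatible with ∼.

    ∧-′-∧ : ∀ x → θ ⊢ e ∧ x ′ ≈ e ∧ (e ∧ x) ′
    ∧-′-∧ x = antisym
      (∧-≤-∧ ≤-refl (′-anti (x∧y≤y _ _)))
      (∧-greatest (x∧y≤x _ _) (≤-trans
        (∧-≤-∧ ≤-refl (reflexive (∧-′ e x)))
        (∨-distrib-≤ (≤-trans (reflexive e∧e′≈⊥) (minimum _)) (x∧y≤y _ _))))

    ∼-∧-cong : Definitions.Congruent₂ _∼_ _∧_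
    ∼-∧-cong {x} {x′} {y} {y′} x∼x′ y∼y′ = begin
      e ∧ (x ∧ y)           ≈⟨ ∧-∧ x y ⟩
      e ∧ ((e ∧ x) ∧ y)     ≈⟨ ∧-congˡ (∧-congʳ x∼x′) ⟩
      e ∧ ((e ∧ x′) ∧ y)    ≈⟨ ∧-∧ x′ y ⟨
      e ∧ (x′ ∧ y)          ≈⟨ ∧-congˡ (∧-comm _ _) ⟩
      e ∧ (y ∧ x′)          ≈⟨ ∧-∧ y x′ ⟩
      e ∧ ((e ∧ y) ∧ x′)    ≈⟨ ∧-congˡ (∧-congʳ y∼y′) ⟩
      e ∧ ((e ∧ y′) ∧ x′)   ≈⟨ ∧-∧ y′ x′ ⟨
      e ∧ (y′ ∧ x′)         ≈⟨ ∧-congˡ (∧-comm _ _) ⟩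
      e ∧ (x′ ∧ y′)         ∎

    ∼-∨-cong : Definitions.Congruent₂ _∼_ _∨_
    ∼-∨-cong {x} {x′} {y} {y′} x∼x′ y∼y′ = begin
      e ∧ (x ∨ y)           ≈⟨ ∧-distribˡ-∨ e x y ⟩
      e ∧ x ∨ e ∧ y         ≈⟨ ∨-cong x∼x′ y∼y′ ⟩
      e ∧ x′ ∨ e ∧ y′       ≈⟨ ∧-distribˡ-∨ e x′ y′ ⟨
      e ∧ (x′ ∨ y′)         ∎

    ∼-⇒-cong : Definitions.Congruent₂ _∼_ _⇒_
    ∼-⇒-cong {x} {x′} {y} {y′} x∼x′ y∼y′ = begin
      e ∧ (x ⇒ y)                ≈⟨ ∧-⇒-∧ e x y ⟩
      e ∧ (e ∧ x ⇒ e ∧ y)        ≈⟨ ∧-congˡ (⇒-cong x∼x′ y∼y′) ⟩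
      e ∧ (e ∧ x′ ⇒ e ∧ y′)      ≈⟨ ∧-⇒-∧ e x′ y′ ⟨
      e ∧ (x′ ⇒ y′)              ∎

    ∼-′-cong : Definitions.Congruent₁ _∼_ _′
    ∼-′-cong {x} {x′} x∼x′ = begin
      e ∧ x ′               ≈⟨ ∧-′-∧ x ⟩
      e ∧ (e ∧ x) ′         ≈⟨ ∧-congˡ (′-cong x∼x′) ⟩
      e ∧ (e ∧ x′) ′        ≈⟨ ∧-′-∧ x′ ⟨
      e ∧ x′ ′              ∎

    ∼-isEquivalence : IsEquivalence _∼_
    ∼-isEquivalence = record { refl = refl ; sym = sym ; trans = ≈-trans }

    quotient : Quotient A
    quotient = record
      { _~_     = _∼_
      ; isEquiv = ∼-isEquivalence
      ; ∨-cong  = ∼-∨-cong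
      ; ∧-cong  = ∼-∧-cong
      ; ⇒-cong  = ∼-⇒-cong
      ; ′-cong  = ∼-′-cong
      ; isJIDL₁ = record
        { isDQD   = record
          { isSemiHeyting = record
            { isLattice = record
              { isEquivalence = ∼-isEquivalence
              ; ∨-comm     = λ x y → ≈⇒∼ (∨-comm x y)
              ; ∨-assoc    = λ x y z → ≈⇒∼ (∨-assoc x y z)
              ; ∨-cong     = ∼-∨-cong
              ; ∧-comm     = λ x y → ≈⇒∼ (∧-comm x y)
              ; ∧-assoc    = λ x y z → ≈⇒∼ (∧-assoc x y z)
              ; ∧-cong     = ∼-∧-cong
              ; absorptive = (λ x y → ≈⇒∼ (∨-absorbs-∧ x y))
                           , (λ x y → ≈⇒∼ (∧-absorbs-∨ x y))
              }
            ; ∧-zeroʳ   = λ x → ≈⇒∼ (∧-zeroʳ x)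
            ; ∨-zeroʳ   = λ x → ≈⇒∼ (∨-zeroʳ x)
            ; ∧-⇒       = λ x y → ≈⇒∼ (∧-⇒ x y)
            ; ∧-⇒-∧     = λ x y z → ≈⇒∼ (∧-⇒-∧ x y z)
            ; ⇒-refl    = λ x → ≈⇒∼ (⇒-refl x)
            }
          ; ⊥′    = ≈⇒∼ ⊥′
          ; ⊤′    = ≈⇒∼ ⊤′
          ; ∧-′   = λ x y → ≈⇒∼ (∧-′ x y)
          ; ∨-′′  = λ x y → ≈⇒∼ (∨-′′ x y)
          ; ′′-≤  = λ x → ≈⇒∼ (′′-≤ x)
          }
        ; jid     = λ x y z → ≈⇒∼ (jid x y z)
        ; linear  = λ x y → ≈⇒∼ (linear x y)
        ; level-1 = λ x → ≈⇒∼ (level-1 x)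
        }
      }

  -- Splitting along the complementary elements core w and (core w) ′.

  decide : ∀ θ w → Loc (λ φ → φ ⊢ w ≈ ⊤ ⊎ φ ⊢ w ≈ w ∧ w ′) θ
  decide θ w = loc λ {x} {y} k → antisym
      (separate (k E.quotient E.≈⇒∼ (inj₁ w∼⊤)) (k E′.quotient E′.≈⇒∼ (inj₂ w≤w′)))
      (separate (sym (k E.quotient E.≈⇒∼ (inj₁ w∼⊤))) (sym (k E′.quotient E′.≈⇒∼ (inj₂ w≤w′))))
    where
    open Q θ
    e = core w
    module E  = Principal θ e (core∧core′≈⊥ w)
    module E′ = Principal θ (e ′) (≤⊥⇒≈⊥ (≤-trans
      (∧-≤-∧ ≤-refl (x′′≤x e)) (reflexive (≈-trans (∧-comm _ _) (core∧core′≈⊥ w)))))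

    w∼⊤ : E.quotient ⊢ w ≈ ⊤
    w∼⊤ = antisym (∧-greatest (x∧y≤x _ _) (maximum _))
      (∧-greatest (x∧y≤x _ _) (≤-trans (x∧y≤x _ _) (x∧y≤x _ _)))

    w≤w′ : E′.quotient ⊢ w ≈ w ∧ w ′
    w≤w′ = Q.core≈⊥⇒≤′ E′.quotient
      (≈-trans (∧-comm _ _) (≈-trans (core∧core′≈⊥ w) (sym (∧-zeroʳ (e ′)))))

    separate : ∀ {x y} → θ ⊢ e ∧ x ≈ e ∧ y → θ ⊢ e ′ ∧ x ≈ e ′ ∧ y → x ≤ y
    separate ex≈ey e′x≈e′y = ≤-trans
      (∧-greatest ≤-refl (≈⊤⇒≥ (core∨core′≈⊤ w)))
      (∨-distrib-≤
        (≤-trans (reflexive (≈-trans (∧-comm _ _) ex≈ey)) (x∧y≤y _ _))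
        (≤-trans (reflexive (≈-trans (∧-comm _ _) e′x≈e′y)) (x∧y≤y _ _)))

  -- A fixed point of ′, as the atoms of D₂ are.  A nontrivial dually Stone
  -- algebra has none.

  FixedPoint : Quotient A → Set (c ⊔ ℓ)
  FixedPoint φ = ∃[ c ] φ ⊢ c ′ ≈ c

  -- If w ≤ w ′ ≤ w ′′ then w ′ is a fixed point, as w ′′ ≤ w.

  dichotomy : ∀ θ w → Loc (λ φ → FixedPoint φ ⊎ (φ ⊢ w ≈ ⊤ ⊎ φ ⊢ w ′ ≈ ⊤)) θ
  dichotomy θ w = bind (decide θ w) λ where
    φ _ (inj₁ w≈⊤)  → return (inj₂ (inj₁ w≈⊤))
    φ _ (inj₂ w≤w′) → bind (decide φ (w ′)) λ where
      ψ _   (inj₁ w′≈⊤)   → return (inj₂ (inj₂ w′≈⊤))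
      ψ φ⊑ψ (inj₂ w′≤w′′) → return (inj₁ (w ′ , (let open Q ψ in
        antisym (≤-trans (x′′≤x w) (φ⊑ψ w≤w′)) w′≤w′′)))

  -- A as a quotient of itself.

  root : IsJIDL₁ A → Quotient A
  root isJIDL₁ = record
    { isEquiv = isEquiv ; ∨-cong = ∨-cong ; ∧-cong = ∧-cong ; ⇒-cong = ⇒-cong
    ; ′-cong = ′-cong ; isJIDL₁ = isJIDL₁ }
    where open Alg A

-- Transfer of identities along relations

-- Every variable of t has an index below bound t.

bound : Term → ℕ
bound (var i)  = suc i
bound (s ∨ₜ t) = bound s ℕ.⊔ bound t
bound (s ∧ₜ t) = bound s ℕ.⊔ bound t
bound (s ⇒ₜ t) = bound s ℕ.⊔ bound t
bound (t ′ₜ)   = bound t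
bound ⊥ₜ       = 0
bound ⊤ₜ       = 0

-- R is a subalgebra of B × A.

record Compatible {b m c ℓ r} (B : Alg b m) (A : Alg c ℓ)
    (R : REL (Alg.Carrier B) (Alg.Carrier A) r) : Set (b ⊔ c ⊔ r) where
  private
    module A = Alg A
    module B = Alg B
  field
    ∨-closed : ∀ {d e x y} → R d x → R e y → R (d B.∨ e) (x A.∨ y)
    ∧-closed : ∀ {d e x y} → R d x → R e y → R (d B.∧ e) (x A.∧ y)
    ⇒-closed : ∀ {d e x y} → R d x → R e y → R (d B.⇒ e) (x A.⇒ y)
    ′-closed : ∀ {d x} → R d x → R (d B.′) (x A.′)
    ⊥-closed : R B.⊥ A.⊥
    ⊤-closed : R B.⊤ A.⊤

module _ {b m c ℓ r} {B : Alg b m} {A : Alg c ℓ}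
    {R : REL (Alg.Carrier B) (Alg.Carrier A) r} (R-compatible : Compatible B A R) where

  open Compatible R-compatible

  ⟦⟧-related : ∀ {N σ ρ} → (∀ {i} → i ℕ.< N → R (σ i) (ρ i)) →
    ∀ t → bound t ℕ.≤ N → R (⟦_⟧ B t σ) (⟦_⟧ A t ρ)
  ⟦⟧-related {N} {σ} {ρ} σRρ = go
    where
    go : ∀ t → bound t ℕ.≤ N → R (⟦_⟧ B t σ) (⟦_⟧ A t ρ)
    go (var i)  b≤N = σRρ b≤N
    go (s ∨ₜ t) b≤N = ∨-closed (go s (ℕ.m⊔n≤o⇒m≤o (bound s) (bound t) b≤N))
      (go t (ℕ.m⊔n≤o⇒n≤o (bound s) (bound t) b≤N))
    go (s ∧ₜ t) b≤N = ∧-closed (go s (ℕ.m⊔n≤o⇒m≤o (bound s) (bound t) b≤N))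
      (go t (ℕ.m⊔n≤o⇒n≤o (bound s) (bound t) b≤N))
    go (s ⇒ₜ t) b≤N = ⇒-closed (go s (ℕ.m⊔n≤o⇒m≤o (bound s) (bound t) b≤N))
      (go t (ℕ.m⊔n≤o⇒n≤o (bound s) (bound t) b≤N))
    go (t ′ₜ)   b≤N = ′-closed (go t b≤N)
    go ⊥ₜ       _   = ⊥-closed
    go ⊤ₜ       _   = ⊤-closed

  -- If R is single-valued, up to an equality ∼ on A, then an identity of B
  -- holds in A, up to ∼, at every assignment in the range of R.

  transfer : ∀ {r′} {_∼_ : Rel (Alg.Carrier A) r′} →
    (∀ {d e x y} → Alg._≈_ B d e → R d x → R e y → x ∼ y) →
    ∀ s t → B ⊨ (s ≈ₜ t) →
    ∀ ρ → (∀ {i} → i ℕ.< bound s ℕ.⊔ bound t → ∃[ d ] R d (ρ i)) →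
    ⟦_⟧ A s ρ ∼ ⟦_⟧ A t ρ
  transfer functional s t B⊨s≈t ρ lifted = functional (B⊨s≈t σ)
    (⟦⟧-related σRρ s (ℕ.m≤m⊔n (bound s) (bound t)))
    (⟦⟧-related σRρ t (ℕ.m≤n⊔m (bound s) (bound t)))
    where
    N = bound s ℕ.⊔ bound t

    -- Variables not occurring in s and t are sent to ⊥.

    choose : ∀ i → ∃[ d ] (i ℕ.< N → R d (ρ i))
    choose i with i ℕ.<? N
    ... | yes i<N = proj₁ (lifted i<N) , λ _ → proj₂ (lifted i<N)
    ... | no i≮N  = Alg.⊥ B , λ i<N → contradiction i<N i≮N

    σ = proj₁ ∘ choose

    σRρ : ∀ {i} → i ℕ.< N → R (σ i) (ρ i)
    σRρ {i} = proj₂ (choose i)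

-- Quotients with a fixed point

module FixedPoints {c ℓ} (A : Alg c ℓ) where

  open Alg A hiding (_≤_; isEquiv; ∨-cong; ∧-cong; ⇒-cong; ′-cong)
  open Local A

  -- The elements c and d behave like the atoms a and b of D₂.

  record Atoms (φ : Quotient A) (c d : Carrier) : Set ℓ where
    field
      c′≈c  : φ ⊢ c ′ ≈ c
      d′≈d  : φ ⊢ d ′ ≈ d
      c∧d≈⊥ : φ ⊢ c ∧ d ≈ ⊥
      c∨d≈⊤ : φ ⊢ c ∨ d ≈ ⊤

  open Atoms

  Atoms-swap : ∀ {φ c d} → Atoms φ c d → Atoms φ d c
  Atoms-swap {φ} at = record
    { c′≈c  = d′≈d at
    ; d′≈d  = c′≈c at
    ; c∧d≈⊥ = ≈-trans (∧-comm _ _) (c∧d≈⊥ at)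
    ; c∨d≈⊤ = ≈-trans (∨-comm _ _) (c∨d≈⊤ at)
    } where open Q φ

  Atoms-⊑ : ∀ {φ ψ c d} → φ ⊑ ψ → Atoms φ c d → Atoms ψ c d
  Atoms-⊑ φ⊑ψ at = record
    { c′≈c  = φ⊑ψ (c′≈c at)
    ; d′≈d  = φ⊑ψ (d′≈d at)
    ; c∧d≈⊥ = φ⊑ψ (c∧d≈⊥ at)
    ; c∨d≈⊤ = φ⊑ψ (c∨d≈⊤ at)
    }

  -- A fixed point c is complemented, being of the form x ′, and locally its
  -- complement is also a fixed point.

  atoms : ∀ φ → FixedPoint φ → Loc (λ ψ → ∃[ c ] ∃[ d ] Atoms ψ c d) φ
  atoms φ (c , c′≈c) = bind (decide φ (c * ′)) λ where
      ψ φ⊑ψ (inj₁ d′≈⊤)  → trivial (⊤≈⊥ ψ (φ⊑ψ c′≈c) (φ⊑ψ c∨c*≈⊤) d′≈⊤)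
      ψ φ⊑ψ (inj₂ d′≤d′′) → return (c , c * , record
        { c′≈c  = φ⊑ψ c′≈c
        ; d′≈d  = Q.antisym ψ
            (Q.≤-trans ψ d′≤d′′ (Q.x′′≤x ψ (c *))) (φ⊑ψ c*≤c*′)
        ; c∧d≈⊥ = φ⊑ψ (Q.x∧x*≈⊥ φ c)
        ; c∨d≈⊤ = φ⊑ψ c∨c*≈⊤
        })
    where
    c∨c*≈⊤ : φ ⊢ c ∨ c * ≈ ⊤
    c∨c*≈⊤ = begin
      c ∨ c *          ≈⟨ ∨-cong c′≈c (⇒-cong c′≈c refl) ⟨
      c ′ ∨ (c ′) *    ≈⟨ x′∨x′*≈⊤ c ⟩
      ⊤                ∎
      where
      open Q φ
      open Quotient φ using (∨-cong; ⇒-cong)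
      open import Relation.Binary.Reasoning.Setoid setoid

    c*≤c*′ : φ ⊢ c * ≈ c * ∧ c * ′
    c*≤c*′ = ≤-trans
      (∧-greatest ≤-refl (≈⊤⇒≥ c′∨c*′≈⊤))
      (∨-distrib-≤ (≤-trans (∧-≤-∧ ≤-refl (reflexive c′≈c))
        (≤-trans (reflexive (≈-trans (∧-comm _ _) (x∧x*≈⊥ c))) (minimum _)))
        (x∧y≤y _ _))
      where
      open Q φ
      c′∨c*′≈⊤ : φ ⊢ c ′ ∨ c * ′ ≈ ⊤
      c′∨c*′≈⊤ = ≈-trans (sym (∧-′ c (c *)))
        (≈-trans (Quotient.′-cong φ (x∧x*≈⊥ c)) ⊥′)

    ⊤≈⊥ : ∀ ψ → ψ ⊢ c ′ ≈ c → ψ ⊢ c ∨ c * ≈ ⊤ → ψ ⊢ c * ′ ≈ ⊤ → ψ ⊢ ⊤ ≈ ⊥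
    ⊤≈⊥ ψ c′≈c c∨c*≈⊤ c*′≈⊤ = begin
      ⊤    ≈⟨ c≈⊤ ⟨
      c    ≈⟨ c′≈c ⟨
      c ′  ≈⟨ Quotient.′-cong ψ c≈⊤ ⟩
      ⊤ ′  ≈⟨ ⊤′ ⟩
      ⊥    ∎
      where
      open Q ψ
      open import Relation.Binary.Reasoning.Setoid setoid
      c≈⊤ : ψ ⊢ c ≈ ⊤
      c≈⊤ = ∨≈⊤∧′≈⊤⇒≈⊤ (≈-trans (∨-comm _ _) c∨c*≈⊤) c*′≈⊤

  -- The coordinate of x at the atom c: the meet c ∧ x is c or ⊥, according to
  -- the Boolean.

  Value : Quotient A → Carrier → Bool → Carrier → Set ℓ
  Value φ c true  x = φ ⊢ c ≈ c ∧ x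
  Value φ c false x = φ ⊢ c ∧ x ≈ ⊥

  Value-⊑ : ∀ {φ ψ c x} → φ ⊑ ψ → ∀ p → Value φ c p x → Value ψ c p x
  Value-⊑ φ⊑ψ true  v = φ⊑ψ v
  Value-⊑ φ⊑ψ false v = φ⊑ψ v

  module _ {φ : Quotient A} {c : Carrier} where

    open Q φ

    Value-∨ : ∀ p q {x y} → Value φ c p x → Value φ c q y → Value φ c (p Bool.∨ q) (x ∨ y)
    Value-∨ true  _     c≤x   _     = ≤-trans c≤x (x≤x∨y _ _)
    Value-∨ false true  _     c≤y   = ≤-trans c≤y (y≤x∨y _ _)
    Value-∨ false false c∧x≈⊥ c∧y≈⊥ =
      ≤⊥⇒≈⊥ (∨-distrib-≤ (reflexive c∧x≈⊥) (reflexive c∧y≈⊥))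

    Value-∧ : ∀ p q {x y} → Value φ c p x → Value φ c q y → Value φ c (p Bool.∧ q) (x ∧ y)
    Value-∧ true  true  c≤x   c≤y   = ∧-greatest c≤x c≤y
    Value-∧ true  false _     c∧y≈⊥ =
      ≤⊥⇒≈⊥ (≤-trans (∧-≤-∧ ≤-refl (x∧y≤y _ _)) (reflexive c∧y≈⊥))
    Value-∧ false _     c∧x≈⊥ _     =
      ≤⊥⇒≈⊥ (≤-trans (∧-≤-∧ ≤-refl (x∧y≤x _ _)) (reflexive c∧x≈⊥))

    Value-⇒ : ∀ p q {x y} → Value φ c p x → Value φ c q y → Value φ c (not p Bool.∨ q) (x ⇒ y)
    Value-⇒ true  true  _     c≤y   = transpose-⇨ (≤-trans (x∧y≤x _ _) c≤y)
    Value-⇒ true  false c≤x   c∧y≈⊥ = ≤⊥⇒≈⊥ (≤-trans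
      (∧-greatest (x∧y≤x _ _) (≤-trans (∧-≤-∧ c≤x ≤-refl) (∧-⇒-≤ _ _)))
      (reflexive c∧y≈⊥))
    Value-⇒ false _     c∧x≈⊥ _     =
      transpose-⇨ (≤-trans (reflexive c∧x≈⊥) (minimum _))

    -- As in D₂, the coordinate of x ′ at one atom is that of x at the other,
    -- negated.

    Value-′ : ∀ {d} → Atoms φ c d → ∀ q {x} → Value φ d q x → Value φ c (not q) (x ′)
    Value-′ at true  d≤x   = ≤⊥⇒≈⊥ (≤-trans
      (∧-≤-∧ ≤-refl (≤-trans (′-anti d≤x) (reflexive (d′≈d at))))
      (reflexive (c∧d≈⊥ at)))
    Value-′ at false {x} d∧x≈⊥ = ≤-trans (reflexive (sym (c′≈c at))) (′-anti x≤c)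
      where
      x≤c : x ≤ c
      x≤c = ≤-trans (∧-greatest ≤-refl (≈⊤⇒≥ (c∨d≈⊤ at))) (∨-distrib-≤ (x∧y≤y _ _)
        (≤-trans (reflexive (≈-trans (∧-comm _ _) d∧x≈⊥)) (minimum _)))

    Value-≤ : ∀ p {x y} → Value φ c p x → Value φ c p y → c ∧ x ≤ y
    Value-≤ true  _     c≤y = ≤-trans (x∧y≤x _ _) c≤y
    Value-≤ false c∧x≈⊥ _   = ≤-trans (reflexive c∧x≈⊥) (minimum _)

  -- Locally every element has a coordinate at c: split along x ∨ d.  If
  -- x ∨ d ≈ ⊤ then c ≤ x, and x ∨ d ≤ (x ∨ d) ′ ≤ d ′ ≈ d forces x ≤ d.

  value : ∀ φ {c d} → Atoms φ c d → ∀ x → Loc (λ ψ → ∃[ p ] Value ψ c p x) φ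
  value φ {c} {d} at x = bind (decide φ (x ∨ d)) λ where
    ψ φ⊑ψ (inj₁ x∨d≈⊤) → return (true , (let open Q ψ in ≤-trans
      (∧-greatest ≤-refl (≈⊤⇒≥ x∨d≈⊤)) (∨-distrib-≤ (x∧y≤y _ _)
        (≤-trans (reflexive (φ⊑ψ (c∧d≈⊥ at))) (minimum _)))))
    ψ φ⊑ψ (inj₂ x∨d≤[x∨d]′) → return (false , (let open Q ψ in ≤⊥⇒≈⊥ (≤-trans
      (∧-≤-∧ ≤-refl (≤-trans (x≤x∨y x d) (≤-trans x∨d≤[x∨d]′
        (≤-trans (′-anti (y≤x∨y x d)) (reflexive (φ⊑ψ (d′≈d at)))))))
      (reflexive (φ⊑ψ (c∧d≈⊥ at))))))

  -- Both coordinates, that is, the element of D₂ which x corresponds to.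

  Value² : Quotient A → Carrier → Carrier → Bool × Bool → Carrier → Set ℓ
  Value² φ c d (p , q) x = Value φ c p x × Value φ d q x

  value² : ∀ φ {c d} → Atoms φ c d → ∀ x → Loc (λ ψ → ∃[ pq ] Value² ψ c d pq x) φ
  value² φ at x = bind (value φ at x) λ ψ φ⊑ψ (p , v) →
    bind (value ψ (Atoms-swap (Atoms-⊑ φ⊑ψ at)) x) λ χ ψ⊑χ (q , w) →
    return ((p , q) , Value-⊑ ψ⊑χ p v , w)

  Value²-compatible : ∀ {φ c d} → Atoms φ c d → Compatible D₂ A (Value² φ c d)
  Value²-compatible {φ} at = record
    { ∨-closed = λ { {p , q} {p′ , q′} (v , w) (v′ , w′) →
        Value-∨ p p′ v v′ , Value-∨ q q′ w w′ }
    ; ∧-closed = λ { {p , q} {p′ , q′} (v , w) (v′ , w′) →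
        Value-∧ p p′ v v′ , Value-∧ q q′ w w′ }
    ; ⇒-closed = λ { {p , q} {p′ , q′} (v , w) (v′ , w′) →
        Value-⇒ p p′ v v′ , Value-⇒ q q′ w w′ }
    ; ′-closed = λ { {p , q} (v , w) →
        Value-′ at q w , Value-′ (Atoms-swap at) p v }
    ; ⊥-closed = ∧-zeroʳ _ , ∧-zeroʳ _
    ; ⊤-closed = maximum _ , maximum _
    } where open Q φ

  Value²-functional : ∀ {φ c d} → Atoms φ c d →
    ∀ {pq rs x y} → pq ≡ rs → Value² φ c d pq x → Value² φ c d rs y → φ ⊢ x ≈ y
  Value²-functional {φ} at {p , q} ≡.refl (v , w) (v′ , w′) =
    antisym (below v v′ w w′) (below v′ v w′ w)
    where
    open Q φ
    below : ∀ {x y} → Value φ _ p x → Value φ _ p y → Value φ _ q x → Value φ _ q y → x ≤ y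
    below v v′ w w′ = ≤-trans
      (∧-greatest ≤-refl (≈⊤⇒≥ (c∨d≈⊤ at)))
      (∨-distrib-≤ (≤-trans (reflexive (∧-comm _ _)) (Value-≤ p v v′))
                   (≤-trans (reflexive (∧-comm _ _)) (Value-≤ q w w′)))

  values² : ∀ φ {c d} → Atoms φ c d → ∀ xs →
    Loc (λ ψ → All (λ x → ∃[ pq ] Value² ψ c d pq x) xs) φ
  values² φ at []       = return []
  values² φ at (x ∷ xs) = bind (value² φ at x) λ ψ φ⊑ψ ((p , q) , v , w) →
    bind (values² ψ (Atoms-⊑ φ⊑ψ at) xs) λ χ ψ⊑χ vs →
    return (((p , q) , Value-⊑ ψ⊑χ p v , Value-⊑ ψ⊑χ q w) ∷ vs)

  -- Identities of D₂ hold in every quotient with a fixed point.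

  fixedPoint⇒⊨ : ∀ s t → D₂ ⊨ (s ≈ₜ t) → ∀ φ → FixedPoint φ →
    ∀ ρ → φ ⊢ ⟦_⟧ A s ρ ≈ ⟦_⟧ A t ρ
  fixedPoint⇒⊨ s t D₂⊨s≈t φ fp ρ =
    glue (atoms φ fp) λ ψ _ (c , d , at) →
    glue (values² ψ at (applyUpTo ρ N)) λ χ ψ⊑χ vs →
    transfer (Value²-compatible (Atoms-⊑ ψ⊑χ at)) (Value²-functional (Atoms-⊑ ψ⊑χ at))
      s t D₂⊨s≈t ρ (λ i<N → All.applyUpTo⁻ ρ N vs i<N)
    where N = bound s ℕ.⊔ bound t

-- Quotients without fixed points

module Chains {c ℓ} (A : Alg c ℓ) where

  open Alg A hiding (_≤_; isEquiv; ∨-cong; ∧-cong; ⇒-cong; ′-cong)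
  open Local A

  private
    variable
      p q : Level
      P : Quotient A → Set p
      P′ : Quotient A → Set q
      θ : Quotient A

  -- P holds locally, except at quotients with a fixed point of ′.

  ChainLoc : (Quotient A → Set p) → Quotient A → Set (c ⊔ ℓsuc ℓ ⊔ p)
  ChainLoc P = Loc (λ φ → FixedPoint φ ⊎ P φ)

  returnᶜ : P θ → ChainLoc P θ
  returnᶜ p = return (inj₂ p)

  bindᶜ : ChainLoc P θ → (∀ φ → θ ⊑ φ → P φ → ChainLoc P′ φ) → ChainLoc P′ θ
  bindᶜ m f = bind m λ where
    φ _   (inj₁ fp) → return (inj₁ fp)
    φ θ⊑φ (inj₂ p)  → f φ θ⊑φ p

  Comparable : Carrier → Carrier → Quotient A → Set ℓ
  Comparable x y φ =
    φ ⊢ x ≈ y ⊎ (φ ⊢ x ≺ y × φ ⊢ x ′ ≈ ⊤) ⊎ (φ ⊢ y ≺ x × φ ⊢ y ′ ≈ ⊤)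

  compare : ∀ θ x y → ChainLoc (Comparable x y) θ
  compare θ x y = bindᶜ (dichotomy θ (x ⇒ y)) λ where
    φ _ (inj₁ x⇒y≈⊤) → bindᶜ (dichotomy φ (y ⇒ x)) λ where
      ψ φ⊑ψ (inj₁ y⇒x≈⊤)  → returnᶜ (inj₁ (let open Q ψ in
        antisym (⇒-⊤⇒≤ (φ⊑ψ x⇒y≈⊤)) (⇒-⊤⇒≤ y⇒x≈⊤)))
      ψ φ⊑ψ (inj₂ y⇒x′≈⊤) → returnᶜ (inj₂ (inj₁ (let open Q ψ in
        ≤∧⇒′≈⊤⇒≺ (⇒-⊤⇒≤ (φ⊑ψ x⇒y≈⊤)) y⇒x′≈⊤)))
    φ _ (inj₂ x⇒y′≈⊤) → returnᶜ (inj₂ (inj₂ (let open Q φ in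
      ≤∧⇒′≈⊤⇒≺ (⇒-⊤⇒≤ (∨≈⊤∧′≈⊤⇒≈⊤ (linear x y) x⇒y′≈⊤)) x⇒y′≈⊤)))

  -- The elements that do not contribute to joins equal to ⊤.

  Dense : Quotient A → Carrier → Set ℓ
  Dense φ x = φ ⊢ x ′ ≈ ⊤

  -- A strictly ascending list of dense elements.

  Ascending : Quotient A → List Carrier → Set (c ⊔ ℓ)
  Ascending φ xs = Linked (φ ⊢_≺_) xs × All (Dense φ) xs

  Ascending-⊑ : ∀ φ ψ {xs} → φ ⊑ ψ → Ascending φ xs → Ascending ψ xs
  Ascending-⊑ φ ψ φ⊑ψ (linked , dense) =
    Linked.map (≺-⊑ {φ} {ψ} φ⊑ψ) linked , All.map φ⊑ψ dense

  infix 4 _∈[_]_ _⊆[_]_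

  -- Membership and inclusion up to the equality of the quotient.

  _∈[_]_ : Carrier → Quotient A → List Carrier → Set (c ⊔ ℓ)
  x ∈[ φ ] xs = Any (φ ⊢ x ≈_) xs

  _⊆[_]_ : List Carrier → Quotient A → List Carrier → Set (c ⊔ ℓ)
  xs ⊆[ φ ] ys = ∀ x → x ∈[ φ ] xs → x ∈[ φ ] ys

  -- Insertion into the part of an ascending list above a.

  insert : ∀ θ a x xs → θ ⊢ a ≺ x → Dense θ x → Ascending θ (a ∷ xs) →
    ChainLoc (λ φ → ∃[ ys ] Ascending φ (a ∷ ys) × x ∈[ φ ] ys × xs ⊆[ φ ] ys) θ
  insert θ a x [] a≺x x-dense (_ , a-dense ∷ _) = returnᶜ
    (x ∷ [] , (a≺x ∷ [-] , a-dense ∷ x-dense ∷ []) , here (Q.refl θ) , λ _ ())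
  insert θ a x (b ∷ xs) a≺x x-dense asc = bindᶜ (compare θ x b) λ where
    φ θ⊑φ (inj₁ x≈b) → returnᶜ
      (b ∷ xs , Ascending-⊑ θ φ θ⊑φ asc , here x≈b , λ _ y∈xs → y∈xs)
    φ θ⊑φ (inj₂ (inj₁ (x≺b , _))) → case Ascending-⊑ θ φ θ⊑φ asc of λ where
      (_ ∷ linked , a-dense ∷ dense) → returnᶜ
        (x ∷ b ∷ xs ,
         (≺-⊑ {θ} {φ} θ⊑φ a≺x ∷ x≺b ∷ linked , a-dense ∷ θ⊑φ x-dense ∷ dense) ,
         here (Q.refl φ) , λ _ → there)
    φ θ⊑φ (inj₂ (inj₂ (b≺x , _))) → case Ascending-⊑ θ φ θ⊑φ asc of λ where
      (a≺b ∷ linked , a-dense ∷ dense) →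
        bindᶜ (insert φ b x xs b≺x (θ⊑φ x-dense) (linked , dense)) λ where
          ψ φ⊑ψ (ys , (linked′ , dense′) , x∈ys , xs⊆ys) → returnᶜ
            (b ∷ ys ,
             (≺-⊑ {φ} {ψ} φ⊑ψ a≺b ∷ linked′ , φ⊑ψ a-dense ∷ dense′) ,
             there x∈ys ,
             λ { _ (here y≈b) → here y≈b ; y (there y∈xs) → there (xs⊆ys y y∈xs) })

  -- The chain given by the list xs consists of ⊥, of xs and of ⊤.

  Listed : Quotient A → List Carrier → Carrier → Set (c ⊔ ℓ)
  Listed φ xs x = φ ⊢ x ≈ ⊤ ⊎ x ∈[ φ ] ⊥ ∷ xs

  Listed-⊑ : ∀ φ ψ {xs ys} → φ ⊑ ψ → xs ⊆[ ψ ] ys →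
    ∀ {x} → Listed φ xs x → Listed ψ ys x
  Listed-⊑ φ ψ φ⊑ψ xs⊆ys (inj₁ x≈⊤)           = inj₁ (φ⊑ψ x≈⊤)
  Listed-⊑ φ ψ φ⊑ψ xs⊆ys (inj₂ (here x≈⊥))    = inj₂ (here (φ⊑ψ x≈⊥))
  Listed-⊑ φ ψ φ⊑ψ xs⊆ys (inj₂ (there x∈xs))  =
    inj₂ (there (xs⊆ys _ (Any.map φ⊑ψ x∈xs)))

  -- All elements of xs lie in the chain of an ascending list.

  Sorted : List Carrier → Quotient A → Set (c ⊔ ℓ)
  Sorted xs φ = ∃[ ys ] Ascending φ (⊥ ∷ ys) × All (Listed φ ys) xs

  sort : ∀ θ xs → ChainLoc (Sorted xs) θ
  sort θ []       = returnᶜ ([] , ([-] , Q.⊥′ θ ∷ []) , [])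
  sort θ (x ∷ xs) = bindᶜ (sort θ xs) λ φ _ (ys , asc , listed) →
    let
      keep : ∀ ψ → φ ⊑ ψ → Listed ψ ys x → Sorted (x ∷ xs) ψ
      keep ψ φ⊑ψ x-listed = ys , Ascending-⊑ φ ψ φ⊑ψ asc ,
        x-listed ∷ All.map (Listed-⊑ φ ψ φ⊑ψ (λ _ y∈ys → y∈ys)) listed
    in
    bindᶜ (dichotomy φ x) λ where
      ψ φ⊑ψ (inj₁ x≈⊤)     → returnᶜ (keep ψ φ⊑ψ (inj₁ x≈⊤))
      ψ φ⊑ψ (inj₂ x-dense) → bindᶜ (compare ψ ⊥ x) λ χ ψ⊑χ →
        let
          φ⊑χ : φ ⊑ χ
          φ⊑χ e = ψ⊑χ (φ⊑ψ e)
        in λ where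
          (inj₁ ⊥≈x) → returnᶜ (keep χ φ⊑χ (inj₂ (here (Q.sym χ ⊥≈x))))
          (inj₂ (inj₂ ((x≤⊥ , _) , _))) →
            returnᶜ (keep χ φ⊑χ (inj₂ (here (Q.≤⊥⇒≈⊥ χ x≤⊥))))
          (inj₂ (inj₁ (⊥≺x , _))) →
            bindᶜ (insert χ ⊥ x ys ⊥≺x (ψ⊑χ x-dense) (Ascending-⊑ φ χ φ⊑χ asc))
            λ ω χ⊑ω (zs , asc′ , x∈zs , ys⊆zs) → returnᶜ
              (zs , asc′ , inj₂ (there x∈zs) ∷
               All.map (Listed-⊑ φ ω (λ e → χ⊑ω (φ⊑χ e)) ys⊆zs) listed)

  -- A join of dense elements is ⊤ only in the one-element algebra.

  ⋁-dense : ∀ {φ} ρ ts → All (λ t → Dense φ (⟦_⟧ A t ρ)) ts →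
    φ ⊢ ⟦_⟧ A (⋁ ts) ρ ≈ ⊤ → φ ⊢ ⊤ ≈ ⊥
  ⋁-dense {φ} ρ [] _ ⊥≈⊤ = Q.sym φ ⊥≈⊤
  ⋁-dense {φ} ρ (t ∷ []) (dense ∷ _) t≈⊤ =
    ≈-trans (sym dense) (≈-trans (Quotient.′-cong φ t≈⊤) ⊤′)
    where open Q φ
  ⋁-dense {φ} ρ (t ∷ u ∷ us) (dense ∷ denses) ⋁≈⊤ =
    ⋁-dense {φ} ρ (u ∷ us) denses (Q.∨≈⊤∧′≈⊤⇒≈⊤ φ ⋁≈⊤ dense)

  -- The value past the end of the list is irrelevant, except that ⊥ is dense.

  nth : List Carrier → ℕ → Carrier
  nth []       _       = ⊥
  nth (x ∷ xs) zero    = x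
  nth (x ∷ xs) (suc i) = nth xs i

  nth-dense : ∀ φ {xs} → All (Dense φ) xs → ∀ i → Dense φ (nth xs i)
  nth-dense φ []              i       = Q.⊥′ φ
  nth-dense φ (dense ∷ _)     zero    = dense
  nth-dense φ (_     ∷ dense) (suc i) = nth-dense φ dense i

  nth-≺ : ∀ φ {xs} → Linked (φ ⊢_≺_) xs → ∀ i → suc i ℕ.< length xs →
    φ ⊢ nth xs i ≺ nth xs (suc i)
  nth-≺ φ [-]          i       (ℕ.s≤s ())
  nth-≺ φ (x≺y ∷ _)    zero    _             = x≺y
  nth-≺ φ (_ ∷ linked) (suc i) (ℕ.s≤s i<n)   = nth-≺ φ linked i i<n

  -- The chain identity is evaluated at x₁ ≻ ⋯ ≻ xₖ₊₂, so the first k + 2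
  -- elements of the ascending list are taken in reverse order.

  descending : ℕ → List Carrier → ℕ → Carrier
  descending k xs i = nth xs (suc k ℕ.∸ i)

  -- At this assignment each xᵢ is dense, and so is xᵢ → xᵢ₊₁ ≈ xᵢ₊₁.

  chainIdentity⇒short : ∀ φ {k xs} → Ascending φ xs → 2+ k ℕ.≤ length xs →
    φ ⊢ ⟦_⟧ A (Identity.lhs (chainIdentity (2+ k))) (descending k xs) ≈ ⊤ →
    φ ⊢ ⊤ ≈ ⊥
  chainIdentity⇒short φ {k} {xs} (linked , dense) k+2≤n =
    ⋁-dense {φ} (descending k xs)
      (map var (upTo (2+ k)) ++ map (λ i → var i ⇒ₜ var (suc i)) (upTo (suc k)))
      (All.++⁺
        (All.map⁺ (All.universal (λ i → nth-dense φ dense (suc k ℕ.∸ i)) (upTo (2+ k))))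
        (All.map⁺ (All.applyUpTo⁺₁ (λ i → i) (suc k) step)))
    where
    open Q φ
    step : ∀ {i} → i ℕ.< suc k →
      Dense φ (descending k xs i ⇒ descending k xs (suc i))
    step {i} (ℕ.s≤s i≤k) rewrite ℕ.+-∸-assoc 1 i≤k =
      ≈-trans (Quotient.′-cong φ (proj₂ (nth-≺ φ linked (k ℕ.∸ i)
        (ℕ.≤-trans (ℕ.s≤s (ℕ.s≤s (ℕ.m∸n≤m k i))) k+2≤n))))
        (nth-dense φ dense (k ℕ.∸ i))

  -- Let the list be x₀ ≺ ⋯ ≺ xₘ₋₁ with m ≤ n.  In the chain 0 < ⋯ < n the
  -- element d < m corresponds to the list element at position d, the top n
  -- corresponds to ⊤, and the elements in between to nothing.  The elements
  -- with a counterpart form a subalgebra of the chain.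

  Rank : Quotient A → List Carrier → ∀ {n} → Fin (suc n) → Carrier → Set ℓ
  Rank φ []       {n}     d       x = d ≡ fromℕ n × φ ⊢ x ≈ ⊤
  Rank φ (a ∷ as)         zero    x = φ ⊢ x ≈ a
  Rank φ (a ∷ as) {suc n} (suc d) x = Rank φ as d x

  Rank-exists : ∀ φ as {n} → length as ℕ.≤ n → ∀ {x} → x ∈[ φ ] as →
    ∃[ d ] Rank φ as {n} d x
  Rank-exists φ (a ∷ as)         _             (here x≈a)   = zero , x≈a
  Rank-exists φ (a ∷ as) {suc n} (ℕ.s≤s m≤n) (there x∈as) =
    let d , r = Rank-exists φ as m≤n x∈as in suc d , r

  Rank-top : ∀ φ as {n} → length as ℕ.≤ n → ∀ {x} → φ ⊢ x ≈ ⊤ →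
    Rank φ as (fromℕ n) x
  Rank-top φ []       _             x≈⊤ = ≡.refl , x≈⊤
  Rank-top φ (a ∷ as) (ℕ.s≤s m≤n) x≈⊤ = Rank-top φ as m≤n x≈⊤

  Rank-resp-≈ : ∀ φ as {n} (d : Fin (suc n)) {x y} → φ ⊢ x ≈ y →
    Rank φ as d y → Rank φ as d x
  Rank-resp-≈ φ []               d       x≈y (d≡top , y≈⊤) = d≡top , Q.≈-trans φ x≈y y≈⊤
  Rank-resp-≈ φ (a ∷ as)         zero    x≈y y≈a = Q.≈-trans φ x≈y y≈a
  Rank-resp-≈ φ (a ∷ as) {suc n} (suc d) x≈y r   = Rank-resp-≈ φ as d x≈y r

  Rank-functional : ∀ φ as {n} (d : Fin (suc n)) {x y} →
    Rank φ as d x → Rank φ as d y → φ ⊢ x ≈ y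
  Rank-functional φ []               d       (_ , x≈⊤) (_ , y≈⊤) = Q.≈-trans φ x≈⊤ (Q.sym φ y≈⊤)
  Rank-functional φ (a ∷ as)         zero    x≈a y≈a = Q.≈-trans φ x≈a (Q.sym φ y≈a)
  Rank-functional φ (a ∷ as) {suc n} (suc d) r s = Rank-functional φ as d r s

  Rank-≺-all : ∀ φ {a} as {n} → All (φ ⊢ a ≺_) as → (d : Fin (suc n)) →
    ∀ {x} → Rank φ as d x → φ ⊢ a ≺ x
  Rank-≺-all φ []               []           d       (_ , x≈⊤) =
    Q.≺-resp-≈ φ (Q.refl φ) (Q.sym φ x≈⊤) (Q.≺⊤ φ _)
  Rank-≺-all φ (b ∷ as)         (a≺b ∷ _)    zero    x≈b =
    Q.≺-resp-≈ φ (Q.refl φ) (Q.sym φ x≈b) a≺b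
  Rank-≺-all φ (b ∷ as) {suc n} (_ ∷ a≺as)   (suc d) r   = Rank-≺-all φ as a≺as d r

  Rank-mono : ∀ φ as {n} → AllPairs (φ ⊢_≺_) as → (d e : Fin (suc n)) → d Fin.< e →
    ∀ {x y} → Rank φ as d x → Rank φ as e y → φ ⊢ x ≺ y
  Rank-mono φ [] _ d e d<e (≡.refl , _) (≡.refl , _) = contradiction d<e (ℕ.<-irrefl ≡.refl)
  Rank-mono φ (a ∷ as) {suc n} (a≺as ∷ _) zero (suc e) _ x≈a r =
    Q.≺-resp-≈ φ (Q.sym φ x≈a) (Q.refl φ) (Rank-≺-all φ as a≺as e r)
  Rank-mono φ (a ∷ as) {suc n} (_ ∷ pairs) (suc d) (suc e) (ℕ.s≤s d<e) r s =
    Rank-mono φ as pairs d e d<e r s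

  Rank-dense : ∀ φ as {n} → All (Dense φ) as → (d : Fin (suc n)) → d ≢ fromℕ n →
    ∀ {x} → Rank φ as d x → Dense φ x
  Rank-dense φ [] _ d d≢top (d≡top , _) = contradiction d≡top d≢top
  Rank-dense φ (a ∷ as) (dense ∷ _) zero _ x≈a =
    Q.≈-trans φ (Quotient.′-cong φ x≈a) dense
  Rank-dense φ (a ∷ as) {suc n} (_ ∷ dense) (suc d) d≢top r =
    Rank-dense φ as dense d (d≢top ∘ ≡.cong suc) r

  Rank-compatible : ∀ {φ k as} → Ascending φ (⊥ ∷ as) → length as ℕ.≤ k →
    Compatible (Cᵈᵖ (2+ k)) A (Rank φ (⊥ ∷ as) {suc k})
  Rank-compatible {φ} {k} {as} (linked , dense) m≤k = record
    { ∨-closed = λ {d} {e} → ∨-closed d e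
    ; ∧-closed = λ {d} {e} → ∧-closed d e
    ; ⇒-closed = λ {d} {e} → ⇒-closed d e
    ; ′-closed = λ {d} → ′-closed d
    ; ⊥-closed = refl
    ; ⊤-closed = top refl
    }
    where
    open Q φ
    open Chain k
    module Mx = Max (Fin.≤-totalOrder (2+ k))

    L = ⊥ ∷ as

    R : Fin (2+ k) → Carrier → Set ℓ
    R = Rank φ L

    pairs : AllPairs (φ ⊢_≺_) L
    pairs = Linked.Linked⇒AllPairs ≺-trans linked

    top : ∀ {x} → φ ⊢ x ≈ ⊤ → R 1ᶜ x
    top = Rank-top φ L (ℕ.s≤s m≤k)

    mono : ∀ d e → d Fin.≤ e → ∀ {x y} → R d x → R e y → x ≤ y
    mono d e d≤e r s with d Fin.≟ e
    ... | yes ≡.refl = reflexive (Rank-functional φ L d r s)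
    ... | no d≢e     = proj₁ (Rank-mono φ L pairs d e (Fin.≤∧≢⇒< d≤e d≢e) r s)

    ∨-closed : ∀ d e {x y} → R d x → R e y → R (d ⊔ᶠ e) (x ∨ y)
    ∨-closed d e r s with Fin.≤-total d e
    ... | inj₁ d≤e rewrite Mx.x≤y⇒x⊔y≈y d≤e =
      Rank-resp-≈ φ L e (antisym (∨-least (mono d e d≤e r s) ≤-refl) (y≤x∨y _ _)) s
    ... | inj₂ e≤d rewrite Mx.x≤y⇒y⊔x≈y e≤d =
      Rank-resp-≈ φ L d (antisym (∨-least ≤-refl (mono e d e≤d s r)) (x≤x∨y _ _)) r

    ∧-closed : ∀ d e {x y} → R d x → R e y → R (d ⊓ e) (x ∧ y)
    ∧-closed d e r s with Fin.≤-total d e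
    ... | inj₁ d≤e =
      Rank-resp-≈ φ L d (antisym (x∧y≤x _ _) (∧-greatest ≤-refl (mono d e d≤e r s))) r
    ... | inj₂ e≤d =
      Rank-resp-≈ φ L e (antisym (x∧y≤y _ _) (∧-greatest (mono e d e≤d s r) ≤-refl)) s

    ⇒-closed : ∀ d e {x y} → R d x → R e y → R (d ⇒ᶜ e) (x ⇒ y)
    ⇒-closed d e r s with ℕ.≤-<-connex (toℕ d) (toℕ e)
    ... | inj₁ d≤e rewrite dec-true (d Fin.≤? e) d≤e = top (≤⇒⇒-⊤ (mono d e d≤e r s))
    ... | inj₂ e<d rewrite dec-false (d Fin.≤? e) (ℕ.<⇒≱ e<d) =
      Rank-resp-≈ φ L e (proj₂ (Rank-mono φ L pairs e d e<d s r)) s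

    ′-closed : ∀ d {x} → R d x → R (d ′ᶜ) (x ′)
    ′-closed d r with d Fin.≟ 1ᶜ
    ... | yes ≡.refl = ≈-trans (Quotient.′-cong φ (Rank-functional φ L 1ᶜ r (top refl))) ⊤′
    ... | no d≢1     = top (Rank-dense φ L dense d d≢1 r)

  ⊨⇒⊨ : ∀ {k} s t → D₂ ⊨ (s ≈ₜ t) → Cᵈᵖ (2+ k) ⊨ (s ≈ₜ t) →
    IsJIDL₁ A → A ⊨ chainIdentity (2+ k) → A ⊨ (s ≈ₜ t)
  ⊨⇒⊨ {k} s t D₂⊨ C⊨ isJIDL₁ A⊨chain ρ =
    glue (sort (root isJIDL₁) (applyUpTo ρ N)) λ where
      φ _ (inj₁ fp) → FixedPoints.fixedPoint⇒⊨ A s t D₂⊨ φ fp ρ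
      φ A⊑φ (inj₂ (as , asc , listed)) → chain φ A⊑φ as asc listed
    where
    N = bound s ℕ.⊔ bound t

    chain : ∀ φ → root isJIDL₁ ⊑ φ → ∀ as → Ascending φ (⊥ ∷ as) →
      All (Listed φ as) (applyUpTo ρ N) → φ ⊢ ⟦_⟧ A s ρ ≈ ⟦_⟧ A t ρ
    chain φ A⊑φ as asc listed with length as ℕ.≤? k
    ... | no  m≰k = Q.⊤≈⊥⇒≈ φ (chainIdentity⇒short φ asc (ℕ.s≤s (ℕ.≰⇒> m≰k))
      (A⊑φ (A⊨chain (descending k (⊥ ∷ as))))) _ _
    ... | yes m≤k = transfer (Rank-compatible asc m≤k)
        (λ { {d} ≡.refl → Rank-functional φ (⊥ ∷ as) d }) s t C⊨ ρ
        (λ i<N → ranked (All.applyUpTo⁻ ρ N listed i<N))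
      where
      ranked : ∀ {x} → Listed φ as x → ∃[ d ] Rank φ (⊥ ∷ as) {suc k} d x
      ranked (inj₁ x≈⊤)  = fromℕ (suc k) , Rank-top φ (⊥ ∷ as) (ℕ.s≤s m≤k) x≈⊤
      ranked (inj₂ x∈as) = Rank-exists φ (⊥ ∷ as) (ℕ.s≤s m≤k) x∈as

-- Identities of the generators

-- An equational axiomatisation of JIDL₁.

data JIDL₁-Axiom : Pred Identity 0ℓ where
  ∨-commₐ   : JIDL₁-Axiom (var 0 ∨ₜ var 1 ≈ₜ var 1 ∨ₜ var 0)
  ∨-assocₐ  : JIDL₁-Axiom ((var 0 ∨ₜ var 1) ∨ₜ var 2 ≈ₜ var 0 ∨ₜ (var 1 ∨ₜ var 2))
  ∧-commₐ   : JIDL₁-Axiom (var 0 ∧ₜ var 1 ≈ₜ var 1 ∧ₜ var 0)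
  ∧-assocₐ  : JIDL₁-Axiom ((var 0 ∧ₜ var 1) ∧ₜ var 2 ≈ₜ var 0 ∧ₜ (var 1 ∧ₜ var 2))
  ∨-absorbₐ : JIDL₁-Axiom (var 0 ∨ₜ (var 0 ∧ₜ var 1) ≈ₜ var 0)
  ∧-absorbₐ : JIDL₁-Axiom (var 0 ∧ₜ (var 0 ∨ₜ var 1) ≈ₜ var 0)
  ∧-zeroₐ   : JIDL₁-Axiom (var 0 ∧ₜ ⊥ₜ ≈ₜ ⊥ₜ)
  ∨-zeroₐ   : JIDL₁-Axiom (var 0 ∨ₜ ⊤ₜ ≈ₜ ⊤ₜ)
  ∧-⇒ₐ      : JIDL₁-Axiom (var 0 ∧ₜ (var 0 ⇒ₜ var 1) ≈ₜ var 0 ∧ₜ var 1)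
  ∧-⇒-∧ₐ    : JIDL₁-Axiom (var 0 ∧ₜ (var 1 ⇒ₜ var 2) ≈ₜ
              var 0 ∧ₜ ((var 0 ∧ₜ var 1) ⇒ₜ (var 0 ∧ₜ var 2)))
  ⇒-reflₐ   : JIDL₁-Axiom ((var 0 ⇒ₜ var 0) ≈ₜ ⊤ₜ)
  ⊥′ₐ       : JIDL₁-Axiom (⊥ₜ ′ₜ ≈ₜ ⊤ₜ)
  ⊤′ₐ       : JIDL₁-Axiom (⊤ₜ ′ₜ ≈ₜ ⊥ₜ)
  ∧-′ₐ      : JIDL₁-Axiom ((var 0 ∧ₜ var 1) ′ₜ ≈ₜ var 0 ′ₜ ∨ₜ var 1 ′ₜ)
  ∨-′′ₐ     : JIDL₁-Axiom (((var 0 ∨ₜ var 1) ′ₜ) ′ₜ ≈ₜ (var 0 ′ₜ) ′ₜ ∨ₜ (var 1 ′ₜ) ′ₜ)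
  ′′-≤ₐ     : JIDL₁-Axiom ((var 0 ′ₜ) ′ₜ ∧ₜ var 0 ≈ₜ (var 0 ′ₜ) ′ₜ)
  jidₐ      : JIDL₁-Axiom (var 0 ′ₜ ∨ₜ (var 1 ⇒ₜ var 2) ≈ₜ
              ((var 0 ′ₜ ∨ₜ var 1) ⇒ₜ (var 0 ′ₜ ∨ₜ var 2)))
  linearₐ   : JIDL₁-Axiom ((var 0 ⇒ₜ var 1) ∨ₜ (var 1 ⇒ₜ var 0) ≈ₜ ⊤ₜ)
  level-1ₐ  : JIDL₁-Axiom (var 0 ∧ₜ (var 0 ′ₜ ⇒ₜ ⊥ₜ) ≈ₜ
              ((var 0 ∧ₜ (var 0 ′ₜ ⇒ₜ ⊥ₜ)) ′ₜ ⇒ₜ ⊥ₜ))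

module _ {c ℓ} {A : Alg c ℓ} where

  open Alg A using (Carrier)

  JIDL₁⇒Mod : A ∈ JIDL₁ → A ∈ Mod JIDL₁-Axiom
  JIDL₁⇒Mod isJIDL₁ = λ where
      ∨-commₐ   ρ → ∨-comm (ρ 0) (ρ 1)
      ∨-assocₐ  ρ → ∨-assoc (ρ 0) (ρ 1) (ρ 2)
      ∧-commₐ   ρ → ∧-comm (ρ 0) (ρ 1)
      ∧-assocₐ  ρ → ∧-assoc (ρ 0) (ρ 1) (ρ 2)
      ∨-absorbₐ ρ → ∨-absorbs-∧ (ρ 0) (ρ 1)
      ∧-absorbₐ ρ → ∧-absorbs-∨ (ρ 0) (ρ 1)
      ∧-zeroₐ   ρ → ∧-zeroʳ (ρ 0)
      ∨-zeroₐ   ρ → ∨-zeroʳ (ρ 0)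
      ∧-⇒ₐ      ρ → ∧-⇒ (ρ 0) (ρ 1)
      ∧-⇒-∧ₐ    ρ → ∧-⇒-∧ (ρ 0) (ρ 1) (ρ 2)
      ⇒-reflₐ   ρ → ⇒-refl (ρ 0)
      ⊥′ₐ       ρ → ⊥′
      ⊤′ₐ       ρ → ⊤′
      ∧-′ₐ      ρ → ∧-′ (ρ 0) (ρ 1)
      ∨-′′ₐ     ρ → ∨-′′ (ρ 0) (ρ 1)
      ′′-≤ₐ     ρ → ′′-≤ (ρ 0)
      jidₐ      ρ → jid (ρ 0) (ρ 1) (ρ 2)
      linearₐ   ρ → linear (ρ 0) (ρ 1)
      level-1ₐ  ρ → level-1 (ρ 0)
    where open JIDL₁-Properties isJIDL₁

  Mod⇒JIDL₁ : A ∈ Mod JIDL₁-Axiom → A ∈ JIDL₁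
  Mod⇒JIDL₁ A⊨ = record
    { isDQD = record
      { isSemiHeyting = record
        { isLattice = record
          { isEquivalence = Alg.isEquiv A
          ; ∨-comm     = λ x y → A⊨ ∨-commₐ (assign x y y)
          ; ∨-assoc    = λ x y z → A⊨ ∨-assocₐ (assign x y z)
          ; ∨-cong     = Alg.∨-cong A
          ; ∧-comm     = λ x y → A⊨ ∧-commₐ (assign x y y)
          ; ∧-assoc    = λ x y z → A⊨ ∧-assocₐ (assign x y z)
          ; ∧-cong     = Alg.∧-cong A
          ; absorptive = (λ x y → A⊨ ∨-absorbₐ (assign x y y))
                       , (λ x y → A⊨ ∧-absorbₐ (assign x y y))
          }
        ; ∧-zeroʳ = λ x → A⊨ ∧-zeroₐ (assign x x x)
        ; ∨-zeroʳ = λ x → A⊨ ∨-zeroₐ (assign x x x)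
        ; ∧-⇒     = λ x y → A⊨ ∧-⇒ₐ (assign x y y)
        ; ∧-⇒-∧   = λ x y z → A⊨ ∧-⇒-∧ₐ (assign x y z)
        ; ⇒-refl  = λ x → A⊨ ⇒-reflₐ (assign x x x)
        }
      ; ⊥′   = A⊨ ⊥′ₐ (λ _ → Alg.⊥ A)
      ; ⊤′   = A⊨ ⊤′ₐ (λ _ → Alg.⊥ A)
      ; ∧-′  = λ x y → A⊨ ∧-′ₐ (assign x y y)
      ; ∨-′′ = λ x y → A⊨ ∨-′′ₐ (assign x y y)
      ; ′′-≤ = λ x → A⊨ ′′-≤ₐ (assign x x x)
      }
    ; jid     = λ x y z → A⊨ jidₐ (assign x y z)
    ; linear  = λ x y → A⊨ linearₐ (assign x y y)
    ; level-1 = λ x → A⊨ level-1ₐ (assign x x x)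
    }
    where
    assign : Carrier → Carrier → Carrier → ℕ → Carrier
    assign x y z 0 = x
    assign x y z 1 = y
    assign x y z _ = z

  ⋁-upper : (isJIDL₁ : A ∈ JIDL₁) → let open JIDL₁-Properties isJIDL₁ in
    ∀ ρ {t} ts → t ∈ₗ ts → ⟦_⟧ A t ρ ≤ ⟦_⟧ A (⋁ ts) ρ
  ⋁-upper isJIDL₁ ρ ts t∈ts = go ts t∈ts
    where
    open JIDL₁-Properties isJIDL₁
    go : ∀ {t} ts → t ∈ₗ ts → ⟦_⟧ A t ρ ≤ ⟦_⟧ A (⋁ ts) ρ
    go (t ∷ [])     (here ≡.refl) = ≤-refl
    go (t ∷ u ∷ us) (here ≡.refl) = x≤x∨y _ _
    go (t ∷ u ∷ us) (there t∈us)  = ≤-trans (go (u ∷ us) t∈us) (y≤x∨y _ _)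

var∈chain : ∀ k → var 0 ∈ₗ map var (upTo (2+ k)) ++
  map (λ i → var i ⇒ₜ var (suc i)) (upTo (suc k))
var∈chain k = here ≡.refl

⇒∈chain : ∀ {k i} → i ℕ.< suc k → (var i ⇒ₜ var (suc i)) ∈ₗ
  map var (upTo (2+ k)) ++ map (λ i → var i ⇒ₜ var (suc i)) (upTo (suc k))
⇒∈chain {k} i<k+1 = ∈-++⁺ʳ (map var (upTo (2+ k)))
  (∈-map⁺ (λ i → var i ⇒ₜ var (suc i)) (∈-upTo⁺ i<k+1))

module _ (k : ℕ) where

  private
    C = Cᵈᵖ (2+ k)
    module Mx = Max (Fin.≤-totalOrder (2+ k))
    module Mn = Min (Fin.≤-totalOrder (2+ k))
  open Alg C hiding (_≤_)
  open IsDuallyStoneHeytingChain (Cᵈᵖ-isDuallyStoneHeytingChain k)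
  open IsDQD isDQD
  open IsSemiHeyting isSemiHeyting
  open IsHeyting isHeyting using (∧⇒-⊤)

  private
    ′-cases : ∀ x → x ≡ ⊤ ⊎ x ′ ≡ ⊤
    ′-cases x with x Fin.≟ ⊤
    ... | yes x≡⊤ = inj₁ x≡⊤
    ... | no _    = inj₂ ≡.refl

    ⊥∨ : ∀ x → ⊥ ∨ x ≡ x
    ⊥∨ = Mx.⊔-identityˡ (λ _ → ℕ.z≤n)

    ⊤∨ : ∀ x → ⊤ ∨ x ≡ ⊤
    ⊤∨ = Mx.⊔-zeroˡ Fin.≤fromℕ

  Cᵈᵖ-isJIDL₁ : C ∈ JIDL₁
  Cᵈᵖ-isJIDL₁ = record
    { isDQD = isDQD ; jid = jid ; linear = linear ; level-1 = level-1 }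
    where
    jid : ∀ x y z → x ′ ∨ (y ⇒ z) ≡ (x ′ ∨ y) ⇒ (x ′ ∨ z)
    jid x y z with ′-cases x
    ... | inj₁ ≡.refl rewrite ⊤′ | ⊥∨ y | ⊥∨ z = ⊥∨ (y ⇒ z)
    ... | inj₂ x′≡⊤ rewrite x′≡⊤ | ⊤∨ y | ⊤∨ z | ⇒-refl ⊤ = ⊤∨ (y ⇒ z)

    linear : ∀ x y → (x ⇒ y) ∨ (y ⇒ x) ≡ ⊤
    linear x y with ≤-total x y
    ... | inj₁ x≤y = ≡.trans (≡.cong (_∨ (y ⇒ x))
      (≡.trans (≡.cong (_⇒ y) (≡.sym x≤y)) (∧⇒-⊤ x y))) (⊤∨ (y ⇒ x))
    ... | inj₂ y≤x = ≡.trans (≡.cong ((x ⇒ y) ∨_)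
      (≡.trans (≡.cong (_⇒ x) (≡.sym y≤x)) (∧⇒-⊤ y x))) (∨-zeroʳ (x ⇒ y))

    level-1 : ∀ x → x ∧ (x ′) * ≡ ((x ∧ (x ′) *) ′) *
    level-1 x with ′-cases x
    ... | inj₁ ≡.refl = ≡.trans core⊤≡⊤
      (≡.sym (≡.trans (≡.cong (λ y → (y ′) *) core⊤≡⊤) ⊤′*≡⊤))
      where
      ⊤′*≡⊤ : (⊤ ′) * ≡ ⊤
      ⊤′*≡⊤ = ≡.trans (≡.cong _* ⊤′) (⇒-refl ⊥)

      core⊤≡⊤ : ⊤ ∧ (⊤ ′) * ≡ ⊤
      core⊤≡⊤ = ≡.trans (≡.cong (⊤ ∧_) ⊤′*≡⊤) (Mn.⊓-idem ⊤)
    ... | inj₂ x′≡⊤ rewrite x′≡⊤ | ∧-zeroʳ x | ⊥′ = ≡.refl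

  -- A sequence which never ascends or stays constant drops by at least 1 at
  -- each step.

  descent : ∀ (ρ : ℕ → Carrier) m →
    (∃[ i ] i ℕ.< m × ρ i Fin.≤ ρ (suc i)) ⊎ m ℕ.+ toℕ (ρ m) ℕ.≤ toℕ (ρ 0)
  descent ρ zero    = inj₂ ℕ.≤-refl
  descent ρ (suc m) with descent ρ m
  ... | inj₁ (i , i<m , ρi≤) = inj₁ (i , ℕ.m<n⇒m<1+n i<m , ρi≤)
  ... | inj₂ descends with ℕ.≤-<-connex (toℕ (ρ m)) (toℕ (ρ (suc m)))
  ...   | inj₁ ρm≤ = inj₁ (m , ℕ.≤-refl , ρm≤)
  ...   | inj₂ ρm> = inj₂ (ℕ.≤-trans
    (ℕ.≤-reflexive (≡.sym (ℕ.+-suc m _))) (ℕ.≤-trans (ℕ.+-monoʳ-≤ m ρm>) descends))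

  Cᵈᵖ⊨chainIdentity : C ⊨ chainIdentity (2+ k)
  Cᵈᵖ⊨chainIdentity ρ with descent ρ (suc k)
  ... | inj₁ (i , i<k+1 , ρi≤) = ⊤≤⇒≈⊤ (≤-trans
      (reflexive (sym (≤⇒⇒-⊤ {ρ i} {ρ (suc i)} (sym (Mn.x≤y⇒x⊓y≈x ρi≤)))))
      (⋁-upper Cᵈᵖ-isJIDL₁ ρ _ (⇒∈chain i<k+1)))
    where open JIDL₁-Properties Cᵈᵖ-isJIDL₁
  ... | inj₂ descends = ⊤≤⇒≈⊤ (≤-trans (reflexive (sym ρ0≡⊤))
      (⋁-upper Cᵈᵖ-isJIDL₁ ρ _ (var∈chain k)))
    where
    open JIDL₁-Properties Cᵈᵖ-isJIDL₁
    ρ0≡⊤ : ρ 0 ≡ ⊤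
    ρ0≡⊤ = Fin.≤-antisym (Fin.≤fromℕ (ρ 0)) (ℕ.≤-trans
      (ℕ.≤-reflexive (Fin.toℕ-fromℕ (suc k))) (ℕ.≤-trans (ℕ.m≤m+n (suc k) _) descends))

private
  -- The laws of D₂ are decided by evaluation at all elements.

  all-Bool? : ∀ {p} {P : Bool → Set p} → (∀ b → Dec (P b)) → Dec (∀ b → P b)
  all-Bool? P? = map′ (λ { (f , t) false → f ; (f , t) true → t })
    (λ h → h false , h true) (P? false ×-dec P? true)

  all? : ∀ {p} {P : Bool × Bool → Set p} → (∀ x → Dec (P x)) → Dec (∀ x → P x)
  all? P? = map′ (λ { h (a , b) → h a b }) (λ h a b → h (a , b))
    (all-Bool? λ a → all-Bool? λ b → P? (a , b))

  _≟_ : (x y : Bool × Bool) → Dec (x ≡ y)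
  _≟_ = ≡-dec Bool._≟_ Bool._≟_

D₂-isJIDL₁ : D₂ ∈ JIDL₁
D₂-isJIDL₁ = record
  { isDQD = record
    { isSemiHeyting = record
      { isLattice = record
        { isEquivalence = isEquiv
        ; ∨-comm     = from-yes (all? λ x → all? λ y → (x ∨ y) ≟ (y ∨ x))
        ; ∨-assoc    = from-yes (all? λ x → all? λ y → all? λ z →
            ((x ∨ y) ∨ z) ≟ (x ∨ (y ∨ z)))
        ; ∨-cong     = ∨-cong
        ; ∧-comm     = from-yes (all? λ x → all? λ y → (x ∧ y) ≟ (y ∧ x))
        ; ∧-assoc    = from-yes (all? λ x → all? λ y → all? λ z →
            ((x ∧ y) ∧ z) ≟ (x ∧ (y ∧ z)))
        ; ∧-cong     = ∧-cong
        ; absorptive = from-yes (all? λ x → all? λ y → (x ∨ (x ∧ y)) ≟ x)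
                     , from-yes (all? λ x → all? λ y → (x ∧ (x ∨ y)) ≟ x)
        }
      ; ∧-zeroʳ = from-yes (all? λ x → (x ∧ ⊥) ≟ ⊥)
      ; ∨-zeroʳ = from-yes (all? λ x → (x ∨ ⊤) ≟ ⊤)
      ; ∧-⇒     = from-yes (all? λ x → all? λ y → (x ∧ (x ⇒ y)) ≟ (x ∧ y))
      ; ∧-⇒-∧   = from-yes (all? λ x → all? λ y → all? λ z →
          (x ∧ (y ⇒ z)) ≟ (x ∧ ((x ∧ y) ⇒ (x ∧ z))))
      ; ⇒-refl  = from-yes (all? λ x → (x ⇒ x) ≟ ⊤)
      }
    ; ⊥′   = ≡.refl
    ; ⊤′   = ≡.refl
    ; ∧-′  = from-yes (all? λ x → all? λ y → ((x ∧ y) ′) ≟ (x ′ ∨ y ′))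
    ; ∨-′′ = from-yes (all? λ x → all? λ y → (((x ∨ y) ′) ′) ≟ ((x ′) ′ ∨ (y ′) ′))
    ; ′′-≤ = from-yes (all? λ x → ((x ′) ′ ∧ x) ≟ ((x ′) ′))
    }
  ; jid     = from-yes (all? λ x → all? λ y → all? λ z →
      (x ′ ∨ (y ⇒ z)) ≟ ((x ′ ∨ y) ⇒ (x ′ ∨ z)))
  ; linear  = from-yes (all? λ x → all? λ y → ((x ⇒ y) ∨ (y ⇒ x)) ≟ ⊤)
  ; level-1 = from-yes (all? λ x → (x ∧ (x ′) *) ≟ (((x ∧ (x ′) *) ′) *))
  }
  where open Alg D₂

-- In a Boolean algebra x₁ ∨ (x₁ → x₂) is already ⊤.

D₂⊨chainIdentity : ∀ k → D₂ ⊨ chainIdentity (2+ k)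
D₂⊨chainIdentity k ρ = ⊤≤⇒≈⊤ (≤-trans (reflexive (sym (x∨x⇒y≡⊤ (ρ 0) (ρ 1))))
  (∨-least (⋁-upper D₂-isJIDL₁ ρ _ (var∈chain k))
           (⋁-upper D₂-isJIDL₁ ρ _ (⇒∈chain {k} ℕ.z<s))))
  where
  open Alg D₂ using (_∨_; _⇒_; ⊤)
  open JIDL₁-Properties D₂-isJIDL₁
  x∨x⇒y≡⊤ : ∀ x y → x ∨ (x ⇒ y) ≡ ⊤
  x∨x⇒y≡⊤ = from-yes (all? λ x → all? λ y → (x ∨ (x ⇒ y)) ≟ ⊤)

-- Copies of an algebra in higher universes satisfy the same identities.

module _ {b m} (c ℓ : Level) (B : Alg b m) where

  private module B = Alg B

  LiftAlg : Alg (b ⊔ c) (m ⊔ ℓ)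
  LiftAlg = record
    { Carrier = Lift c B.Carrier
    ; _≈_     = λ x y → Lift ℓ (lower x B.≈ lower y)
    ; _∨_     = λ x y → lift (lower x B.∨ lower y)
    ; _∧_     = λ x y → lift (lower x B.∧ lower y)
    ; _⇒_     = λ x y → lift (lower x B.⇒ lower y)
    ; _′      = λ x → lift (lower x B.′)
    ; ⊥       = lift B.⊥
    ; ⊤       = lift B.⊤
    ; isEquiv = record
      { refl  = lift (IsEquivalence.refl B.isEquiv)
      ; sym   = λ x≈y → lift (IsEquivalence.sym B.isEquiv (lower x≈y))
      ; trans = λ x≈y y≈z → lift (IsEquivalence.trans B.isEquiv (lower x≈y) (lower y≈z))
      }
    ; ∨-cong  = λ x≈x′ y≈y′ → lift (B.∨-cong (lower x≈x′) (lower y≈y′))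
    ; ∧-cong  = λ x≈x′ y≈y′ → lift (B.∧-cong (lower x≈x′) (lower y≈y′))
    ; ⇒-cong  = λ x≈x′ y≈y′ → lift (B.⇒-cong (lower x≈x′) (lower y≈y′))
    ; ′-cong  = λ x≈x′ → lift (B.′-cong (lower x≈x′))
    }

  lower-⟦⟧ : ∀ t ρ → lower (⟦_⟧ LiftAlg t ρ) ≡ ⟦_⟧ B t (lower ∘ ρ)
  lower-⟦⟧ (var i)  ρ = ≡.refl
  lower-⟦⟧ (s ∨ₜ t) ρ = ≡.cong₂ B._∨_ (lower-⟦⟧ s ρ) (lower-⟦⟧ t ρ)
  lower-⟦⟧ (s ∧ₜ t) ρ = ≡.cong₂ B._∧_ (lower-⟦⟧ s ρ) (lower-⟦⟧ t ρ)
  lower-⟦⟧ (s ⇒ₜ t) ρ = ≡.cong₂ B._⇒_ (lower-⟦⟧ s ρ) (lower-⟦⟧ t ρ)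
  lower-⟦⟧ (t ′ₜ)   ρ = ≡.cong B._′ (lower-⟦⟧ t ρ)
  lower-⟦⟧ ⊥ₜ       ρ = ≡.refl
  lower-⟦⟧ ⊤ₜ       ρ = ≡.refl

  ⊨⇒LiftAlg⊨ : ∀ e → B ⊨ e → LiftAlg ⊨ e
  ⊨⇒LiftAlg⊨ (s ≈ₜ t) B⊨e ρ = lift (≡.subst₂ B._≈_
    (≡.sym (lower-⟦⟧ s ρ)) (≡.sym (lower-⟦⟧ t ρ)) (B⊨e (lower ∘ ρ)))

  LiftAlg⊨⇒⊨ : ∀ e → LiftAlg ⊨ e → B ⊨ e
  LiftAlg⊨⇒⊨ (s ≈ₜ t) L⊨e ρ = ≡.subst₂ B._≈_
    (lower-⟦⟧ s (lift ∘ ρ)) (lower-⟦⟧ t (lift ∘ ρ)) (lower (L⊨e (lift ∘ ρ)))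

  LiftAlg∈V : LiftAlg ∈ V ｛ B ｝
  LiftAlg∈V E B⊆Mod {e} e∈E = ⊨⇒LiftAlg⊨ e (B⊆Mod {B} ≡.refl e∈E)

-- The generated variety

corollary7p4 : ∀ (n : ℕ) .{{_ : NonTrivial n}} {c ℓ} (A : Alg c ℓ) →
    A ∈ (V ｛ Cᵈᵖ n ｝ ∨ᵛ V ｛ D₂ ｝) ⇔ (A ∈ JIDL₁ × A ⊨ chainIdentity n)
corollary7p4 (2+ k) {c} {ℓ} A = mk⇔ to from
  where
  C = Cᵈᵖ (2+ k)

  E : Pred Identity 0ℓ
  E = JIDL₁-Axiom ∪ ｛ chainIdentity (2+ k) ｝

  C⊆ModE : ｛ C ｝ ⊆ Mod E
  C⊆ModE ≡.refl (inj₁ e∈)     = JIDL₁⇒Mod (Cᵈᵖ-isJIDL₁ k) e∈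
  C⊆ModE ≡.refl (inj₂ ≡.refl) = Cᵈᵖ⊨chainIdentity k

  D₂⊆ModE : ｛ D₂ ｝ ⊆ Mod E
  D₂⊆ModE ≡.refl (inj₁ e∈)     = JIDL₁⇒Mod D₂-isJIDL₁ e∈
  D₂⊆ModE ≡.refl (inj₂ ≡.refl) = D₂⊨chainIdentity k

  V⊆ModE : V {c′ = c} {ℓ′ = ℓ} ｛ C ｝ ∪ V ｛ D₂ ｝ ⊆ Mod E
  V⊆ModE (inj₁ B∈VC) {e} e∈E = B∈VC E (λ {B} → C⊆ModE {B}) {e} e∈E
  V⊆ModE (inj₂ B∈VD) {e} e∈E = B∈VD E (λ {B} → D₂⊆ModE {B}) {e} e∈E

  to : A ∈ (V ｛ C ｝ ∨ᵛ V ｛ D₂ ｝) → A ∈ JIDL₁ × A ⊨ chainIdentity (2+ k)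
  to A∈ = Mod⇒JIDL₁ (λ e∈ → A⊨E (inj₁ e∈)) , A⊨E (inj₂ ≡.refl)
    where
    A⊨E : A ∈ Mod E
    A⊨E {e} = A∈ E (λ {B} → V⊆ModE {B}) {e}

  from : A ∈ JIDL₁ × A ⊨ chainIdentity (2+ k) → A ∈ (V ｛ C ｝ ∨ᵛ V ｛ D₂ ｝)
  from (isJIDL₁ , A⊨chain) F K⊆Mod {e@(s ≈ₜ t)} e∈F = Chains.⊨⇒⊨ A s t
    (LiftAlg⊨⇒⊨ c ℓ D₂ e (K⊆Mod {LiftAlg c ℓ D₂} (inj₂ (LiftAlg∈V c ℓ D₂)) e∈F))
    (LiftAlg⊨⇒⊨ c ℓ C e (K⊆Mod {LiftAlg c ℓ C} (inj₁ (LiftAlg∈V c ℓ C)) e∈F))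
    isJIDL₁ A⊨chain
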